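{- \textsc{Annotated Weighted Vertex Integrity with Vertex Cover} can be solved in time $2^{O(|C|)} n^{O(1)}$, where $C$ is the given vertex cover and $n$ is the number of vertices.
   Context: Graphs are finite, simple and undirected; for $w: V \to \mathbb{Z}^+$ and $X \subseteq V$, $w(X) = \sum_{x\in X} w(x)$. Given $S \subseteq V(G)$, a vertex $v \in S$ is redundant if at most one connected component of $G - S$ contains neighbors of $v$; $S$ is irredundant if it contains no redundant vertex. \textsc{Annotated Weighted Vertex Integrity with Vertex Cover}: given a vertex-weighted graph $G=(V,E,w)$ with $w: V \to \mathbb{Z}^+$, a vertex cover $C$ of $G$, and an integer $w_{\max}$, find a minimum-weight irredundant set $S \subseteq V \setminus C$ such that $w(D) \le w_{\max}$ for every connected component $D$ of $G - S$, or report NO if no such $S$ exists. -}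

module Defs where

open import Data.Bool using (Bool; false; true; if_then_else_; T)
open import Data.Fin using (Fin; toℕ; fromℕ<; remQuot)
open import Data.Fin.Subset using (Subset; _∈_; _∉_; _⊆_; ∁; Nonempty)
open import Data.Fin.Subset.Properties using (_∈?_)
open import Data.Integer as ℤ using (ℤ; +_; -[1+_]; ∣_∣)
open import Data.List using (map; filter; sum; allFin)
open import Data.Nat using (ℕ; suc; _+_; _∸_; _*_; _≤_; _<_; _<?_; _≡ᵇ_)
open import Data.Product using (_×_; ∃-syntax; uncurry)
open import Data.Sum using (_⊎_)
open import Data.Vec using (lookup)
open import Function using (_⇔_)
open import Relation.Binary.Construct.Closure.ReflexiveTransitive using (Star)
open import Relation.Binary.PropositionalEquality using (_≡_)
open import Relation.Nullary using (¬_; yes; no)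

record Graph (n : ℕ) : Set where
  field
    adj    : Fin n → Fin n → Bool
    sym    : ∀ u v → adj u v ≡ adj v u
    irrefl : ∀ v → adj v v ≡ false

  _~_ : Fin n → Fin n → Set
  u ~ v = T (adj u v)

weight : ∀ {n} → (Fin n → ℕ) → Subset n → ℕ
weight {n} w X = sum (map w (filter (_∈? X) (allFin n)))

module _ {n : ℕ} (G : Graph n) where
  open Graph G

  VertexCover : Subset n → Set
  VertexCover C = ∀ u v → u ~ v → u ∈ C ⊎ v ∈ C

  StepOutside : Subset n → Fin n → Fin n → Set
  StepOutside S u v = u ∉ S × v ∉ S × u ~ v

  -- For u , v ∉ S: u and v are joined by a walk in G - S.
  Reachable : Subset n → Fin n → Fin n → Set
  Reachable S = Star (StepOutside S)

  -- D is the vertex set of a connected component of G - S.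
  record Component (S D : Subset n) : Set where
    field
      nonempty : Nonempty D
      avoids   : D ⊆ ∁ S
      class    : ∀ {u} → u ∈ D → ∀ v → v ∈ D ⇔ Reachable S u v

  HasNeighbourIn : Fin n → Subset n → Set
  HasNeighbourIn v D = ∃[ u ] u ∈ D × v ~ u

  -- "At most one component of G - S contains neighbours of v."
  Redundant : Subset n → Fin n → Set
  Redundant S v = ∀ D D′ → Component S D → Component S D′ →
    HasNeighbourIn v D → HasNeighbourIn v D′ → D ≡ D′

  Irredundant : Subset n → Set
  Irredundant S = ∀ v → v ∈ S → ¬ Redundant S v

record Instance : Set where
  field
    n       : ℕ
    G       : Graph n
    w       : Fin n → ℕ
    w-pos   : ∀ v → 0 < w v
    C       : Subset n
    C-cover : VertexCover G C
    wmax    : ℤ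

module _ (I : Instance) where
  open Instance I

  Feasible : Subset n → Set
  Feasible S = S ⊆ ∁ C × Irredundant G S ×
    (∀ D → Component G S D → + weight w D ℤ.≤ wmax)

  Optimal : Subset n → Set
  Optimal S = Feasible S × (∀ S′ → Feasible S′ → weight w S ≤ weight w S′)

-- Machine model: a random access machine with structured control flow.
-- A store holds scalar registers and arrays, all cells containing natural
-- numbers; a program mentions only finitely many registers and arrays, so the
-- arrays can be interleaved in one memory with constant-factor overhead.
-- Every operation has unit cost. The only arithmetic is addition and truncated
-- subtraction: with unit-cost multiplication, t steps could create numbers
-- with exponentially many (in t) bits, whereas one addition exceeds the largest
-- number present by at most one bit.

record Store : Set where
  constructor store
  field
    reg : ℕ → ℕ
    arr : ℕ → ℕ → ℕ
open Store public

infixl 6 _⊕_ _⊖_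
infix  4 _≔_ _[_]≔_
infixr 3 _⨾_

data Exp : Set where
  lit : ℕ → Exp
  var : ℕ → Exp
  _[_]  : ℕ → Exp → Exp
  _⊕_ _⊖_ : Exp → Exp → Exp

data Cmd : Set where
  skip : Cmd
  _≔_ : ℕ → Exp → Cmd
  _[_]≔_ : ℕ → Exp → Exp → Cmd
  _⨾_ : Cmd → Cmd → Cmd
  if_then_else′_ : Exp → Cmd → Cmd → Cmd
  while_do′_ : Exp → Cmd → Cmd

⟦_⟧ : Exp → Store → ℕ
⟦ lit k   ⟧ σ = k
⟦ var x   ⟧ σ = reg σ x
⟦ a [ e ] ⟧ σ = arr σ a (⟦ e ⟧ σ)
⟦ e ⊕ f   ⟧ σ = ⟦ e ⟧ σ + ⟦ f ⟧ σ
⟦ e ⊖ f   ⟧ σ = ⟦ e ⟧ σ ∸ ⟦ f ⟧ σ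

cost : Exp → ℕ
cost (lit k)   = 1
cost (var x)   = 1
cost (a [ e ]) = 1 + cost e
cost (e ⊕ f)   = 1 + cost e + cost f
cost (e ⊖ f)   = 1 + cost e + cost f

update : ∀ {A : Set} → (ℕ → A) → ℕ → A → ℕ → A
update f x y z = if z ≡ᵇ x then y else f z

setReg : ℕ → ℕ → Store → Store
setReg x k σ = store (update (reg σ) x k) (arr σ)

setArr : ℕ → ℕ → ℕ → Store → Store
setArr a i k σ = store (reg σ) (update (arr σ) a (update (arr σ a) i k))

-- ⟨ c , σ ⟩⇓ τ # t : started in σ, the command c halts in τ after time t.
-- Tests take 0 as false and every other value as true.
infix 2 ⟨_,_⟩⇓_#_

data ⟨_,_⟩⇓_#_ : Cmd → Store → Store → ℕ → Set where
  skip : ∀ {σ} → ⟨ skip , σ ⟩⇓ σ # 1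
  assign : ∀ {x e σ} →
    ⟨ x ≔ e , σ ⟩⇓ setReg x (⟦ e ⟧ σ) σ # 1 + cost e
  write : ∀ {a e f σ} →
    ⟨ a [ e ]≔ f , σ ⟩⇓ setArr a (⟦ e ⟧ σ) (⟦ f ⟧ σ) σ # 1 + cost e + cost f
  seq : ∀ {c d ρ σ τ s t} →
    ⟨ c , ρ ⟩⇓ σ # s → ⟨ d , σ ⟩⇓ τ # t → ⟨ c ⨾ d , ρ ⟩⇓ τ # s + t
  if-true : ∀ {e c d σ τ k t} → ⟦ e ⟧ σ ≡ suc k → ⟨ c , σ ⟩⇓ τ # t →
    ⟨ if e then c else′ d , σ ⟩⇓ τ # 1 + cost e + t
  if-false : ∀ {e c d σ τ t} → ⟦ e ⟧ σ ≡ 0 → ⟨ d , σ ⟩⇓ τ # t →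
    ⟨ if e then c else′ d , σ ⟩⇓ τ # 1 + cost e + t
  while-true : ∀ {e c ρ σ τ k s t} → ⟦ e ⟧ ρ ≡ suc k →
    ⟨ c , ρ ⟩⇓ σ # s → ⟨ while e do′ c , σ ⟩⇓ τ # t →
    ⟨ while e do′ c , ρ ⟩⇓ τ # 1 + cost e + s + t
  while-false : ∀ {e c σ} → ⟦ e ⟧ σ ≡ 0 →
    ⟨ while e do′ c , σ ⟩⇓ σ # 1 + cost e

bit : Bool → ℕ
bit b = if b then 1 else 0

-- The array with cells f 0 , … , f (m - 1) followed by zeros.
block : ∀ {m} → (Fin m → ℕ) → ℕ → ℕ
block {m} f i with i <? m
... | yes i<m = f (fromℕ< i<m)
... | no  _   = 0

signBit : ℤ → ℕ
signBit (+ _)    = 0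
signBit -[1+ _ ] = 1

-- Registers 0, 1, 2: n, and the sign and absolute value of wmax.
-- Arrays 0, 1, 2: the weights, the indicator vector of C, and the adjacency
-- matrix in row-major order. All other cells are 0.
input : Instance → Store
input I = store registers arrays
  where
  open Instance I

  registers : ℕ → ℕ
  registers 0 = n
  registers 1 = signBit wmax
  registers 2 = ∣ wmax ∣
  registers _ = 0

  arrays : ℕ → ℕ → ℕ
  arrays 0 = block w
  arrays 1 = block λ v → bit (lookup C v)
  arrays 2 = block λ k → bit (uncurry (Graph.adj G) (remQuot {n} n k))
  arrays _ = λ _ → 0

-- Register 0 is 1 and array 0 starts with the indicator vector of an optimal
-- set, or register 0 is 0 (the answer NO) and there is no feasible set.
Answers : Instance → Store → Set
Answers I τ =
    (reg τ 0 ≡ 1 × ∃[ S ] Optimal I S × (∀ v → arr τ 0 (toℕ v) ≡ bit (lookup S v)))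
  ⊎ (reg τ 0 ≡ 0 × (∀ S → ¬ Feasible I S))

{-# OPTIONS --safe #-}
module Submission where

open import Defs
open import Data.Bool using (Bool; true; false; not; _∧_; _∨_; T)
open import Data.Bool.Properties using (T-∧)
open import Data.Empty using (⊥-elim)
open import Data.Fin using (Fin; zero; suc; toℕ; fromℕ<; combine; remQuot)
import Data.Fin.Properties as Fin
open import Data.Fin.Properties using
  (toℕ-injective; toℕ<n; toℕ-fromℕ<; fromℕ<-toℕ; toℕ-combine; combine-injective; remQuot-combine; any?)
open import Data.Fin.Subset using (Subset; _∈_; _∉_; _⊆_; ∁; Nonempty)
open import Data.Fin.Subset using () renaming (∣_∣ to card)
open import Data.Fin.Subset.Properties using (_∈?_; x∈∁p⇒x∉p; x∉p⇒x∈∁p; ⊆-antisym)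
open import Data.Integer as ℤ using (∣_∣)
import Data.List as List
open import Data.Nat using
  (ℕ; zero; suc; _+_; _∸_; _*_; _^_; _⊔_; ⌊_/2⌋; _≤_; _<_; _≤?_; _<?_; _≟_; _≡ᵇ_; z≤n; s≤s; z<s; >-nonZero)
import Data.Nat.ListAction as ListAction
open import Data.Nat.Properties
open import Data.Product using (_×_; _,_; proj₁; proj₂; ∃-syntax; uncurry)
open import Data.Sum using (_⊎_; inj₁; inj₂; [_,_]′)
open import Data.Unit using (tt)
open import Data.Vec using (lookup; tabulate; []; _∷_)
open import Data.Vec.Properties using (lookup∘tabulate; lookup⇒[]=; []=⇒lookup)
open import Function using (_∘_; _⇔_; mk⇔; Equivalence)
open import Relation.Binary.Construct.Closure.ReflexiveTransitive using (ε; _◅_; _◅◅_; reverse)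
open import Relation.Binary.PropositionalEquality hiding ([_])
open import Relation.Nullary using (¬_; Dec; does; contradiction; yes; no)
open import Relation.Nullary.Decidable using
  (dec-true; dec-false; ¬¬-excluded-middle; decidable-stable; _×-dec_)
open import Algebra.Properties.CommutativeMonoid.Sum +-0-commutativeMonoid using
    (sum; sum-cong-≗; ∑-distrib-+)
open import Algebra.Properties.CommutativeSemigroup +-commutativeSemigroup using ()
  renaming (x∙yz≈y∙xz to +-x∙yz≈y∙xz)
open import Algebra.Properties.CommutativeSemigroup *-commutativeSemigroup using ()
  renaming (x∙yz≈y∙xz to *-x∙yz≈y∙xz; interchange to *-interchange)

-- A feasible set S avoids C, so it is determined by the partition of C into the traces of
-- the components of G - S: a vertex outside C lies in S exactly if its neighbours, which
-- all lie in C, meet two blocks. Conversely, any partition of C into blocks X that have no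
-- edges to C \ X, and whose closure (X and the non-isolated vertices outside C with all
-- neighbours in X) weighs at most wmax, yields a feasible set, even if the blocks are not
-- connected. So a lightest S is found by maximising the total weight of the closures, a
-- dynamic program over the subsets of C: each of n rounds tries, for all triples of subsets,
-- to improve the best partition of Y = X ⊎ Z by the block X and the best partition of Z.
-- With 2^|C| subsets, a round takes time 8^|C| n^O(1).

-- Loop programs

-- Blocks may be disconnected because no walk in `G - S` leaves the closure of its block. So a
-- component is an isolated vertex or part of one closure, hence light; and a removed vertex with
-- all its neighbours in one component would have them all in one block, hence lie in that closure.
-- Isolated vertices outside `C` have no neighbours, so they are redundant, always kept, and only
-- their weights must be tested. The round number bounds the number of blocks: listing blocks by
-- their first vertex in `C` shows that `n` rounds suffice. Rounds update the table in place, so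
-- progress is stated as inequalities between arbitrary bounds on the table before and after, which
-- later growth preserves. The machine shapes the rest. It can neither multiply nor halve, so
-- multiples of `n` and halves are tabulated, conjunctions of bits become truncated sums, and
-- conditions become sums of defects that must vanish. Its semantics is relational, so the algorithm
-- is written with counted loops, for which the final store is a function `run` and the time can be
-- bounded from the program text.

infix  4 _:=_ _[_]:=_
infixr 3 _▸_

data Prog : Set where
  _:=_    : ℕ → Exp → Prog
  _[_]:=_ : ℕ → Exp → Exp → Prog
  _▸_     : Prog → Prog → Prog
  when    : Exp → Prog → Prog
  for     : ℕ → ℕ → Prog → Prog

-- In for x r p, the counter x runs from 0 below the value of register r.
code : Prog → Cmd
code (x := e)      = x ≔ e
code (a [ e ]:= f) = a [ e ]≔ f
code (p ▸ q)       = code p ⨾ code q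
code (when e p)    = if e then code p else′ skip
code (for x r p)   = x ≔ lit 0 ⨾ while var r ⊖ var x do′ (code p ⨾ x ≔ var x ⊕ lit 1)

choose : ∀ {A : Set} → ℕ → A → A → A
choose zero    a b = b
choose (suc _) a b = a

iter : ∀ {A : Set} → ℕ → (A → A) → A → A
iter zero    f a = a
iter (suc k) f a = iter k f (f a)

tick : ℕ → Store → Store
tick x σ = setReg x (reg σ x + 1) σ

run : Prog → Store → Store
run (x := e)      σ = setReg x (⟦ e ⟧ σ) σ
run (a [ e ]:= f) σ = setArr a (⟦ e ⟧ σ) (⟦ f ⟧ σ) σ
run (p ▸ q)       σ = run q (run p σ)
run (when e p)    σ = choose (⟦ e ⟧ σ) (run p σ) σ
run (for x r p)   σ = iter (reg σ r) (λ τ → tick x (run p τ)) (setReg x 0 σ)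

-- Computed Booleans rather than relations: for a concrete program `T (keepsReg r p)` evaluates to
-- the unit type, so frame conditions are later discharged by `_`.
keepsReg keepsArr : ℕ → Prog → Bool
keepsReg r (x := _)      = not (r ≡ᵇ x)
keepsReg r (_ [ _ ]:= _) = true
keepsReg r (p ▸ q)       = keepsReg r p ∧ keepsReg r q
keepsReg r (when _ p)    = keepsReg r p
keepsReg r (for x _ p)   = not (r ≡ᵇ x) ∧ keepsReg r p
keepsArr a (_ := _)      = true
keepsArr a (b [ _ ]:= _) = not (a ≡ᵇ b)
keepsArr a (p ▸ q)       = keepsArr a p ∧ keepsArr a q
keepsArr a (when _ p)    = keepsArr a p
keepsArr a (for _ _ p)   = keepsArr a p

-- `τ` need not be `run p σ`: the intermediate stores of a loop also agree with its start, relative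
-- to the whole loop.
record Agree (p : Prog) (σ τ : Store) : Set where
  constructor agree
  field
    regs : ∀ r → T (keepsReg r p) → reg τ r ≡ reg σ r
    arrs : ∀ a → T (keepsArr a p) → arr τ a ≡ arr σ a
open Agree public

∧-elim : ∀ {a b} → T (a ∧ b) → T a × T b
∧-elim = Equivalence.to T-∧

update-other : ∀ {A : Set} (f : ℕ → A) {x y z} → T (not (z ≡ᵇ x)) → update f x y z ≡ f z
update-other f {x} {z = z} t with z ≡ᵇ x
... | false = refl

update-≡ : ∀ {A : Set} (f : ℕ → A) x {y} → update f x y x ≡ y
update-≡ f x with x ≡ᵇ x in eq
... | true  = refl
... | false = ⊥-elim (subst T eq (≡⇒≡ᵇ x x refl))

update-≢ : ∀ {A : Set} (f : ℕ → A) {x y z} → z ≢ x → update f x y z ≡ f z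
update-≢ f {x} {z = z} z≢x with z ≡ᵇ x in eq
... | true  = contradiction (≡ᵇ⇒≡ z x (subst T (sym eq) tt)) z≢x
... | false = refl

module _ (x r : ℕ) (p : Prog) (p-agrees : ∀ τ → Agree p τ (run p τ)) {σ : Store} where

  agree-start : Agree (for x r p) σ (setReg x 0 σ)
  agree-start = agree (λ s k → update-other (reg σ) (proj₁ (∧-elim k))) (λ _ _ → refl)

  agree-tick : ∀ {τ} → Agree (for x r p) σ τ → Agree (for x r p) σ (tick x (run p τ))
  agree-tick {τ} (agree ρ α) = agree
    (λ s k → trans (update-other (reg (run p τ)) (proj₁ (∧-elim k)))
               (trans (regs (p-agrees τ) s (proj₂ (∧-elim k))) (ρ s k)))
    (λ a k → trans (arrs (p-agrees τ) a k) (α a k))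

  agree-iter : ∀ k {τ} → Agree (for x r p) σ τ →
    Agree (for x r p) σ (iter k (λ τ → tick x (run p τ)) τ)
  agree-iter zero    h = h
  agree-iter (suc k) h = agree-iter k (agree-tick h)

run-agree : ∀ p σ → Agree p σ (run p σ)
agree-after : ∀ p {q σ τ} → Agree q (run p σ) τ → Agree (p ▸ q) σ τ

run-agree (x := e)      σ = agree (λ _ k → update-other (reg σ) k) (λ _ _ → refl)
run-agree (a [ e ]:= f) σ = agree (λ _ _ → refl) (λ _ k → update-other (arr σ) k)
run-agree (p ▸ q)       σ = agree-after p (run-agree q (run p σ))
run-agree (when e p)    σ with ⟦ e ⟧ σ
... | zero  = agree (λ _ _ → refl) (λ _ _ → refl)
... | suc _ = agree (regs (run-agree p σ)) (arrs (run-agree p σ))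
run-agree (for x r p)   σ = agree-iter x r p (run-agree p) (reg σ r) (agree-start x r p (run-agree p))

agree-after p {q} {σ} a = agree
  (λ r k → trans (regs a r (proj₂ (∧-elim {keepsReg r p} k))) (regs (run-agree p σ) r (proj₁ (∧-elim k))))
  (λ b k → trans (arrs a b (proj₂ (∧-elim {keepsArr b p} k))) (arrs (run-agree p σ) b (proj₁ (∧-elim k))))

-- The step receives `Agree` with the start of the loop, so `Inv` has to mention only what the loop
-- changes. Passes are indexed by `Fin N` because they run over vertices or rows.
for-rule : ∀ x r p {σ N} (Inv : ℕ → Store → Set) → reg σ r ≡ N → T (keepsReg x p) →
  Inv 0 (setReg x 0 σ) →
  (∀ (i : Fin N) τ → reg τ x ≡ toℕ i → Agree (for x r p) σ τ →
    Inv (toℕ i) τ → Inv (suc (toℕ i)) (tick x (run p τ))) →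
  Inv N (run (for x r p) σ)
for-rule x r p {σ} Inv refl keeps init step =
  go (reg σ r) 0 _ refl (update-≡ (reg σ) x) (agree-start x r p (run-agree p)) init
  where
  go : ∀ k i τ → i + k ≡ reg σ r → reg τ x ≡ i → Agree (for x r p) σ τ → Inv i τ →
    Inv (reg σ r) (iter k (λ τ → tick x (run p τ)) τ)
  go zero    i τ eq at _ inv = subst (λ j → Inv j τ) (trans (sym (+-identityʳ i)) eq) inv
  go (suc k) i τ eq at a inv =
    go k (suc i) _ (trans (sym (+-suc i k)) eq)
      (trans (update-≡ (reg (run p τ)) x)
          (trans (+-comm _ 1) (cong suc (trans (regs (run-agree p τ) x keeps) at))))
      (agree-tick x r p (run-agree p) a)
      (subst (λ j → Inv (suc j) _) toℕ-j
          (step j τ (trans at (sym toℕ-j)) a (subst (λ j → Inv j τ) (sym toℕ-j) inv)))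
    where
    i<N : i < reg σ r
    i<N = subst (i <_) eq (m<m+n i z<s)
    j = fromℕ< i<N
    toℕ-j : toℕ j ≡ i
    toℕ-j = toℕ-fromℕ< i<N

when-rule : ∀ e p {σ} (Q : Store → Set) →
  (∀ {k} → ⟦ e ⟧ σ ≡ suc k → Q (run p σ)) → (⟦ e ⟧ σ ≡ 0 → Q σ) → Q (run (when e p) σ)
when-rule e p {σ} Q true-case false-case with ⟦ e ⟧ σ
... | zero  = false-case refl
... | suc _ = true-case refl

-- Termination and running time of loop programs

-- Registers 0 and 3 hold the only loop bounds.
stable : ℕ → Bool
stable r = (r ≡ᵇ 0) ∨ (r ≡ᵇ 3)

-- Loop bounds are never assigned and no body touches its own counter. This makes the `while` loop
-- perform exactly the iterations of `run` and keeps the bounds valid in nested loops.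
wf : Prog → Bool
wf (x := _)      = not (stable x)
wf (_ [ _ ]:= _) = true
wf (p ▸ q)       = wf p ∧ wf q
wf (when _ p)    = wf p
wf (for x r p)   = not (stable x) ∧ (stable r ∧ (keepsReg x p ∧ wf p))

size depth : Prog → ℕ
size (x := e)      = 1 + cost e
size (_ [ e ]:= f) = 1 + cost e + cost f
size (p ▸ q)       = size p + size q
size (when e p)    = 2 + cost e + size p
-- Six steps for the initial assignment and the final failing test; eight per pass for the
-- successful test and the increment.
size (for x r p)   = 6 + (8 + size p)
depth (_ := _)      = 0
depth (_ [ _ ]:= _) = 0
depth (p ▸ q)       = depth p ⊔ depth q
depth (when _ p)    = depth p
depth (for _ _ p)   = suc (depth p)

stable≢ : ∀ r x → T (stable r) → T (not (stable x)) → T (not (r ≡ᵇ x))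
stable≢ r x s u with r ≡ᵇ x in eq
... | false = tt
... | true  with ≡ᵇ⇒≡ r x (subst T (sym eq) tt)
... | refl with stable r
... | true  = u

wf-keeps : ∀ p r → T (wf p) → T (stable r) → T (keepsReg r p)
wf-keeps (x := _)      r u s = stable≢ r x s u
wf-keeps (_ [ _ ]:= _) r u s = tt
wf-keeps (p ▸ q)       r u s = Equivalence.from T-∧
  (wf-keeps p r (proj₁ (∧-elim u)) s , wf-keeps q r (proj₂ (∧-elim {wf p} u)) s)
wf-keeps (when _ p)    r u s = wf-keeps p r u s
wf-keeps (for x l p)   r u s = Equivalence.from T-∧
  (stable≢ r x s (proj₁ (∧-elim {not (stable x)} u)) ,
   wf-keeps p r (proj₂ (∧-elim {keepsReg x p}
       (proj₂ (∧-elim {stable l} (proj₂ (∧-elim {not (stable x)} u)))))) s)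

module _ (B : ℕ) where

  -- Base `suc B` instead of `B` keeps the powers positive for `B = 0`, so that constants fit under
  -- the bound at every depth.
  bound : ℕ → ℕ → ℕ
  bound s d = s * suc B ^ d

  Bounded : Store → Set
  Bounded σ = ∀ r → T (stable r) → reg σ r ≤ B

  Terminates : Prog → Store → Set
  Terminates p σ = ∃[ t ] (⟨ code p , σ ⟩⇓ run p σ # t) × t ≤ bound (size p) (depth p)

  ≤bound : ∀ s d → s ≤ bound s d
  ≤bound s d = m≤m*n s (suc B ^ d) {{m^n≢0 (suc B) d}}

  bound-monoʳ : ∀ s {d d′} → d ≤ d′ → bound s d ≤ bound s d′
  bound-monoʳ s d≤ = *-monoʳ-≤ s (^-monoʳ-≤ (suc B) d≤)

  bound-+ : ∀ s s′ d → bound s d + bound s′ d ≡ bound (s + s′) d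
  bound-+ s s′ d = sym (*-distribʳ-+ (suc B ^ d) s s′)

  bounded-run : ∀ p {σ} → T (wf p) → Bounded σ → Bounded (run p σ)
  bounded-run p {σ} u b r s = subst (_≤ B) (sym (regs (run-agree p σ) r (wf-keeps p r u s))) (b r s)

  bounded-setReg : ∀ x {k σ} → T (not (stable x)) → Bounded σ → Bounded (setReg x k σ)
  bounded-setReg x {σ = σ} u b r s = subst (_≤ B) (sym (update-other (reg σ) (stable≢ r x s u))) (b r s)

  -- The value of the loop test is itself the number of passes left, so it serves as the induction
  -- measure.
  terminates-while : ∀ x r p → T (not (stable x)) → T (stable r) → T (keepsReg x p) → T (wf p) →
    (∀ τ → Bounded τ → Terminates p τ) → ∀ k τ → reg τ r ∸ reg τ x ≡ k → Bounded τ →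
    ∃[ t ] (⟨ while var r ⊖ var x do′ (code p ⨾ x ≔ var x ⊕ lit 1) , τ ⟩⇓
              iter k (λ τ → tick x (run p τ)) τ # t)
         × t ≤ k * (8 + bound (size p) (depth p)) + 4
  terminates-while x r p ux sr kx u ih zero    τ eq b = _ , while-false eq , ≤-refl
  terminates-while x r p ux sr kx u ih (suc k) τ eq b
    with ih τ b
  ... | s , body , s≤
    with terminates-while x r p ux sr kx u ih k (tick x (run p τ)) eq′
           (bounded-setReg x {σ = run p τ} ux (bounded-run p {τ} u b))
    where
    τ′ = run p τ
    eq′ : reg (tick x τ′) r ∸ reg (tick x τ′) x ≡ k
    eq′ = begin
      reg (tick x τ′) r ∸ reg (tick x τ′) x
        ≡⟨ cong₂ _∸_ (update-other (reg τ′) (stable≢ r x sr ux)) (update-≡ (reg τ′) x) ⟩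
      reg τ′ r ∸ (reg τ′ x + 1)
        ≡⟨ cong₂ (λ a b → a ∸ (b + 1)) (regs (run-agree p τ) r (wf-keeps p r u sr))
            (regs (run-agree p τ) x kx) ⟩
      reg τ r ∸ (reg τ x + 1)   ≡⟨ ∸-+-assoc (reg τ r) (reg τ x) 1 ⟨
      (reg τ r ∸ reg τ x) ∸ 1   ≡⟨ cong (_∸ 1) eq ⟩
      k                         ∎
      where open ≡-Reasoning
  ... | t , rest , t≤ = _ , while-true eq (seq body assign) rest , (begin
    4 + (s + 4) + t                  ≤⟨ +-mono-≤ (+-monoʳ-≤ 4 (+-monoˡ-≤ 4 s≤)) t≤ ⟩
    4 + (E + 4) + (k * (8 + E) + 4)  ≡⟨ cong (_+ (k * (8 + E) + 4)) (cong (4 +_) (+-comm E 4)) ⟩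
    8 + E + (k * (8 + E) + 4)        ≡⟨ +-assoc (8 + E) (k * (8 + E)) 4 ⟨
    suc k * (8 + E) + 4              ∎)
    where
    open ≤-Reasoning
    E = bound (size p) (depth p)

  terminates : ∀ p σ → T (wf p) → Bounded σ → Terminates p σ
  terminates (x := e) σ u b = _ , assign , ≤bound _ 0
  terminates (a [ e ]:= f) σ u b = _ , write , ≤bound _ 0
  terminates (p ▸ q) σ u b
    with terminates p σ (proj₁ (∧-elim u)) b
       | terminates q (run p σ) (proj₂ (∧-elim {wf p} u)) (bounded-run p {σ} (proj₁ (∧-elim u)) b)
  ... | s , cp , s≤ | t , cq , t≤ = _ , seq cp cq , (begin
    s + t ≤⟨ +-mono-≤ (≤-trans s≤ (bound-monoʳ (size p) (m≤m⊔n dp dq)))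
                      (≤-trans t≤ (bound-monoʳ (size q) (m≤n⊔m dp dq))) ⟩
    bound (size p) (dp ⊔ dq) + bound (size q) (dp ⊔ dq) ≡⟨ bound-+ (size p) (size q) (dp ⊔ dq) ⟩
    bound (size p + size q) (dp ⊔ dq) ∎)
    where
    open ≤-Reasoning
    dp = depth p
    dq = depth q
  terminates (when e p) σ u b with ⟦ e ⟧ σ in eq
  ... | zero  = _ , if-false eq skip , (begin
    1 + cost e + 1        ≡⟨ +-comm (1 + cost e) 1 ⟩
    2 + cost e            ≤⟨ m≤m+n _ (size p) ⟩
    2 + cost e + size p   ≤⟨ ≤bound _ (depth p) ⟩
    bound (2 + cost e + size p) (depth p) ∎)
    where open ≤-Reasoning
  ... | suc _ with terminates p σ u b
  ... | t , cp , t≤ = _ , if-true eq cp , (begin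
    1 + cost e + t                                            ≤⟨ +-mono-≤ (n≤1+n _) t≤ ⟩
    2 + cost e + bound (size p) (depth p)
      ≤⟨ +-monoˡ-≤ _ (≤bound (2 + cost e) (depth p)) ⟩
    bound (2 + cost e) (depth p) + bound (size p) (depth p)   ≡⟨ bound-+ (2 + cost e) (size p) (depth p) ⟩
    bound (2 + cost e + size p) (depth p)                     ∎)
    where open ≤-Reasoning
  terminates (for x r p) σ u b
    with ∧-elim {not (stable x)} u
  ... | ux , u₁ with ∧-elim {stable r} u₁
  ... | sr , u₂ with ∧-elim {keepsReg x p} u₂
  ... | kx , u₃
    with terminates-while x r p ux sr kx u₃ (λ τ → terminates p τ u₃) (reg σ r) (setReg x 0 σ)
           (cong₂ _∸_ (update-other (reg σ) (stable≢ r x sr ux)) (update-≡ (reg σ) x))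
           (bounded-setReg x {0} {σ} ux b)
  ... | t , loop , t≤ = _ , seq assign loop , (begin
    2 + t                                     ≤⟨ +-monoʳ-≤ 2 t≤ ⟩
    2 + (reg σ r * (8 + bound s d) + 4)       ≡⟨ cong (2 +_) (+-comm _ 4) ⟩
    6 + reg σ r * (8 + bound s d)             ≤⟨ +-mono-≤ (≤bound 6 (suc d))
        (*-mono-≤ (m≤n⇒m≤1+n (b r sr)) (+-monoˡ-≤ (bound s d) (≤bound 8 d))) ⟩
    bound 6 (suc d) + suc B * (bound 8 d + bound s d)   ≡⟨ cong (λ k → bound 6 (suc d) + suc B * k)
        (bound-+ 8 s d) ⟩
    bound 6 (suc d) + suc B * ((8 + s) * suc B ^ d)   ≡⟨ cong (bound 6 (suc d) +_)
        (*-x∙yz≈y∙xz (suc B) (8 + s) (suc B ^ d)) ⟩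
    bound 6 (suc d) + bound (8 + s) (suc d)   ≡⟨ bound-+ 6 (8 + s) (suc d) ⟩
    bound (6 + (8 + s)) (suc d)               ∎)
    where
    open ≤-Reasoning
    s = size p
    d = depth p

-- Sums and subsets coded as numbers

sum-zero : ∀ {n} {f : Fin n → ℕ} → (∀ v → f v ≡ 0) → sum f ≡ 0
sum-zero {zero}  z = refl
sum-zero {suc n} z = cong₂ _+_ (z zero) (sum-zero (z ∘ suc))

sum-zero⁻¹ : ∀ {n} (f : Fin n → ℕ) → sum f ≡ 0 → ∀ v → f v ≡ 0
sum-zero⁻¹ f eq zero    = m+n≡0⇒m≡0 (f zero) eq
sum-zero⁻¹ f eq (suc v) = sum-zero⁻¹ (f ∘ suc) (m+n≡0⇒n≡0 (f zero) eq) v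

sum-mono : ∀ {n} {f g : Fin n → ℕ} → (∀ v → f v ≤ g v) → sum f ≤ sum g
sum-mono {zero}  le = z≤n
sum-mono {suc n} le = +-mono-≤ (le zero) (sum-mono (le ∘ suc))

sum-positive : ∀ {n} (f : Fin n → ℕ) → 0 < sum f → ∃[ v ] 0 < f v
sum-positive {suc n} f pos with f zero in eq
... | suc _ = zero , subst (0 <_) (sym eq) z<s
... | zero with sum-positive (f ∘ suc) pos
... | v , p = suc v , p

sum-positive⁻¹ : ∀ {n} (f : Fin n → ℕ) v → 0 < f v → 0 < sum f
sum-positive⁻¹ f zero    p = ≤-trans p (m≤m+n _ _)
sum-positive⁻¹ f (suc v) p = ≤-trans (sum-positive⁻¹ (f ∘ suc) v p) (m≤n+m _ _)

-- The content of an accumulator after `i` passes. The index is a number rather than an element of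
-- `Fin n` so that the invariant also covers the end of the loop.
prefix : ∀ {n} → (Fin n → ℕ) → ℕ → ℕ
prefix {zero}  f i       = 0
prefix {suc n} f zero    = 0
prefix {suc n} f (suc i) = f zero + prefix (f ∘ suc) i

prefix-zero : ∀ {n} (f : Fin n → ℕ) → prefix f 0 ≡ 0
prefix-zero {zero}  f = refl
prefix-zero {suc n} f = refl

prefix-suc : ∀ {n} (f : Fin n → ℕ) v → prefix f (suc (toℕ v)) ≡ prefix f (toℕ v) + f v
prefix-suc f zero    = trans (cong (f zero +_) (prefix-zero (f ∘ suc))) (+-comm (f zero) 0)
prefix-suc f (suc v) = trans (cong (f zero +_) (prefix-suc (f ∘ suc) v)) (sym (+-assoc (f zero) _ _))

prefix-all : ∀ {n} (f : Fin n → ℕ) → prefix f n ≡ sum f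
prefix-all {zero}  f = refl
prefix-all {suc n} f = cong (f zero +_) (prefix-all (f ∘ suc))

guard : ℕ → ℕ → ℕ
guard zero    k = 0
guard (suc _) k = k

indicator : ∀ {n} → Subset n → Fin n → ℕ
indicator C v = bit (lookup C v)

sum-indicator : ∀ {n} (C : Subset n) → sum (indicator C) ≡ card C
sum-indicator []          = refl
sum-indicator (true  ∷ C) = cong suc (sum-indicator C)
sum-indicator (false ∷ C) = sum-indicator C

at : ∀ {k n} → Fin k → Fin n → ℕ
at {n = n} y v = n * toℕ y + toℕ v

at-injective : ∀ {k n} (y z : Fin k) (u v : Fin n) → at y u ≡ at z v → y ≡ z × u ≡ v
at-injective y z u v eq = combine-injective y u z v
  (toℕ-injective (trans (toℕ-combine y u) (trans eq (sym (toℕ-combine z v)))))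

-- Decoding a number into a subset of C: its binary digits, lowest first, are
-- handed out to the members of C in increasing order.

lowBit : ℕ → ℕ
lowBit r = r ∸ (⌊ r /2⌋ + ⌊ r /2⌋)

shift : Bool → ℕ → ℕ
shift true  r = ⌊ r /2⌋
shift false r = r

remaining : ∀ {n} → Subset n → ℕ → ℕ → ℕ
remaining []      r i       = r
remaining (b ∷ C) r zero    = r
remaining (b ∷ C) r (suc i) = remaining C (shift b r) i

-- For bits `a` and `b`, the truncated `(a + b) ∸ 1` is their conjunction. Here it suppresses the
-- digit at a vertex outside `C`.
decode : ∀ {n} → Subset n → ℕ → Fin n → ℕ
decode C r v = (indicator C v + lowBit (remaining C r (toℕ v))) ∸ 1

encode : ∀ {n} → Subset n → (Fin n → ℕ) → ℕ
encode []          X = 0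
encode (true  ∷ C) X = X zero + (encode C (X ∘ suc) + encode C (X ∘ suc))
encode (false ∷ C) X = encode C (X ∘ suc)

remaining-zero : ∀ {n} (C : Subset n) r → remaining C r 0 ≡ r
remaining-zero []      r = refl
remaining-zero (b ∷ C) r = refl

remaining-suc : ∀ {n} (C : Subset n) r v →
  remaining C r (suc (toℕ v)) ≡ shift (lookup C v) (remaining C r (toℕ v))
remaining-suc (b ∷ C) r zero    = remaining-zero C _
remaining-suc (b ∷ C) r (suc v) = remaining-suc C (shift b r) v

shift-≤ : ∀ b r → shift b r ≤ r
shift-≤ true  r = ⌊n/2⌋≤n r
shift-≤ false r = ≤-refl

remaining-≤ : ∀ {n} (C : Subset n) r i → remaining C r i ≤ r
remaining-≤ []      r i       = ≤-refl
remaining-≤ (b ∷ C) r zero    = ≤-refl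
remaining-≤ (b ∷ C) r (suc i) = ≤-trans (remaining-≤ C _ i) (shift-≤ b r)

half-double : ∀ x t → x ≤ 1 → ⌊ x + (t + t) /2⌋ ≡ t
half-double x       zero    z≤n       = refl
half-double x       zero    (s≤s z≤n) = refl
half-double x       (suc t) x≤1       = trans
  (cong ⌊_/2⌋ (trans (cong (x +_) (cong suc (+-suc t t))) (trans (+-suc x _) (cong suc (+-suc x _)))))
  (cong suc (half-double x t x≤1))

lowBit-double : ∀ x t → x ≤ 1 → lowBit (x + (t + t)) ≡ x
lowBit-double x t x≤1 rewrite half-double x t x≤1 = m+n∸n≡m x (t + t)

lowBit-≤1 : ∀ r → lowBit r ≤ 1
lowBit-≤1 0             = z≤n
lowBit-≤1 1             = s≤s z≤n
lowBit-≤1 (suc (suc r)) = subst (_≤ 1)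
  (cong (suc r ∸_) (sym (+-suc ⌊ r /2⌋ ⌊ r /2⌋))) (lowBit-≤1 r)

indicator-≤1 : ∀ {n} (C : Subset n) v → indicator C v ≤ 1
indicator-≤1 C v with lookup C v
... | true  = ≤-refl
... | false = z≤n

decode-≤ : ∀ {n} (C : Subset n) r v → decode C r v ≤ indicator C v
decode-≤ C r v = begin
  (indicator C v + lowBit (remaining C r (toℕ v))) ∸ 1 ≤⟨ ∸-monoˡ-≤ 1
      (+-monoʳ-≤ (indicator C v) (lowBit-≤1 (remaining C r (toℕ v)))) ⟩
  (indicator C v + 1) ∸ 1                              ≡⟨ m+n∸n≡m (indicator C v) 1 ⟩
  indicator C v                                        ∎
  where open ≤-Reasoning

decode-encode : ∀ {n} (C : Subset n) (X : Fin n → ℕ) → (∀ v → X v ≤ indicator C v) →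
  ∀ v → decode C (encode C X) v ≡ X v
decode-encode (true  ∷ C) X X≤ zero    = lowBit-double (X zero) (encode C (X ∘ suc)) (X≤ zero)
decode-encode (false ∷ C) X X≤ zero    = trans
  (n≤0⇒n≡0 (≤-trans (∸-monoˡ-≤ 1 (lowBit-≤1 (encode C (X ∘ suc)))) z≤n)) (sym (n≤0⇒n≡0 (X≤ zero)))
decode-encode (true  ∷ C) X X≤ (suc v)
  rewrite half-double (X zero) (encode C (X ∘ suc)) (X≤ zero) = decode-encode C (X ∘ suc) (X≤ ∘ suc) v
decode-encode (false ∷ C) X X≤ (suc v) = decode-encode C (X ∘ suc) (X≤ ∘ suc) v

encode-< : ∀ {n} (C : Subset n) X → (∀ v → X v ≤ indicator C v) → encode C X < 2 ^ card C
encode-< []          X X≤ = z<s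
encode-< (true  ∷ C) X X≤ = begin
  suc (X zero + (t + t)) ≤⟨ s≤s (+-monoˡ-≤ (t + t) (X≤ zero)) ⟩
  suc (suc (t + t))      ≡⟨ cong suc (+-suc t t) ⟨
  suc t + suc t          ≤⟨ +-mono-≤ t< t< ⟩
  2 ^ card C + 2 ^ card C ≡⟨ cong (2 ^ card C +_) (+-identityʳ _) ⟨
  2 ^ suc (card C)       ∎
  where
  open ≤-Reasoning
  t = encode C (X ∘ suc)
  t< = encode-< C (X ∘ suc) (X≤ ∘ suc)
encode-< (false ∷ C) X X≤ = encode-< C (X ∘ suc) (X≤ ∘ suc)

-- All digits are 1. Hence the answer is read from row `var 4 ⊖ lit 1`.
encode-full : ∀ {n} (C : Subset n) → encode C (indicator C) ≡ 2 ^ card C ∸ 1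
encode-full C = cong (_∸ 1) (go C)
  where
  go : ∀ {n} (C : Subset n) → suc (encode C (indicator C)) ≡ 2 ^ card C
  go []          = refl
  go (true  ∷ C) = trans (cong suc (sym (+-suc _ _)))
    (cong₂ _+_ (go C) (trans (go C) (sym (+-identityʳ _))))
  go (false ∷ C) = go C

decode-zero : ∀ {n} (C : Subset n) v → decode C 0 v ≡ 0
decode-zero C v rewrite n≤0⇒n≡0 (remaining-≤ C 0 (toℕ v)) | +-identityʳ (indicator C v) =
  m≤n⇒m∸n≡0 (indicator-≤1 C v)

-- Blocks, closures and partitions as numerical conditions

module Partitions (I : Instance) where
  open Instance I

  Row : Set
  Row = Fin n → ℕ

  c : Row
  c = indicator C

  e : Fin n → Row
  e v u = bit (Graph.adj G v u)

  inside outside closure : Row → Row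
  inside  X v = sum λ u → (e v u + X u) ∸ 1
  outside X v = sum λ u → (e v u + (c u ∸ X u)) ∸ 1
  -- X together with the vertices outside C that have a neighbour, all of them in X.
  closure X v = X v + (((1 ∸ (1 ∸ inside X v)) ∸ outside X v) ∸ c v)

  -- Vanishes exactly if `k` is at most `wmax`: for negative `wmax` the sign bit alone makes it
  -- positive.
  excess : ℕ → ℕ
  excess k = signBit wmax + (k ∸ ∣ wmax ∣)

  -- For `X` inside `C`, `leak` counts the edges from `X` to the rest of `C`. Guards take the place
  -- of products by a bit, as in the accumulators of the program.
  heaviness leak : Row → ℕ
  heaviness X = sum λ v → guard (closure X v) (w v)
  leak X      = sum λ v → guard (X v) (outside X v)

  isolated : Row
  isolated v = (1 ∸ c v) ∸ sum (e v)

  -- An isolated vertex outside `C` forms a component by itself in every `G - S` with `S`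
  -- irredundant. If one is too heavy, there is no feasible set.
  isolatedExcess : ℕ
  isolatedExcess = sum λ v → guard (isolated v) (excess (w v))

  value : Row → ℕ
  value K = sum λ v → K v * w v

  record Block (X : Row) : Set where
    field
      ≤c     : ∀ v → X v ≤ c v
      closed : leak X ≡ 0
      light  : excess (heaviness X) ≡ 0

  -- Y is split into r blocks, and K is the union of their closures and the isolated vertices.
  data Partition : ℕ → Row → Row → Set where
    empty : ∀ {Y K} → isolatedExcess ≡ 0 → (∀ v → Y v ≡ 0) → (∀ v → K v ≡ isolated v) →
      Partition 0 Y K
    add : ∀ {r X Y Z K J} → Block X → Partition r Z J → (∀ v → Y v ≡ X v + Z v) →
      (∀ v → K v ≡ closure X v + J v) → Partition (suc r) Y K

  partition-resp : ∀ {r Y Y′ K K′} → (∀ v → Y′ v ≡ Y v) → (∀ v → K′ v ≡ K v) →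
    Partition r Y K → Partition r Y′ K′
  partition-resp y k (empty i a b) = empty i (λ v → trans (y v) (a v)) (λ v → trans (k v) (b v))
  partition-resp y k (add B p a b) = add B p (λ v → trans (y v) (a v)) (λ v → trans (k v) (b v))

  module _ {X : Row} (X≤c : ∀ v → X v ≤ c v) where

    closure-≤1 : ∀ v → closure X v ≤ 1
    closure-≤1 v = begin
      X v + ((f ∸ outside X v) ∸ c v) ≤⟨ +-mono-≤ (X≤c v)
          (∸-monoˡ-≤ (c v) (≤-trans (m∸n≤m f (outside X v)) (m∸n≤m 1 (1 ∸ inside X v)))) ⟩
      c v + (1 ∸ c v)                   ≡⟨ m+[n∸m]≡n (indicator-≤1 C v) ⟩
      1                                 ∎
      where
      open ≤-Reasoning
      f = 1 ∸ (1 ∸ inside X v)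

    heaviness-value : heaviness X ≡ value (closure X)
    heaviness-value = sum-cong-≗ λ v → guard-* (closure X v) (closure-≤1 v) (w v)
      where
      guard-* : ∀ a → a ≤ 1 → ∀ k → guard a k ≡ a * k
      guard-* zero    _         k = refl
      guard-* (suc .0) (s≤s z≤n) k = sym (+-identityʳ k)

  value-+ : ∀ {K X J : Row} → (∀ v → K v ≡ X v + J v) → value K ≡ value X + value J
  value-+ {K} {X} {J} eq = trans
    (sum-cong-≗ λ v → trans (cong (_* w v) (eq v)) (*-distribʳ-+ (w v) (X v) (J v)))
    (∑-distrib-+ (λ v → X v * w v) (λ v → J v * w v))

-- Partitions of C and feasible sets

pos⇒∈ : ∀ {n} {X : Subset n} {v} → 0 < indicator X v → v ∈ X
pos⇒∈ {X = X} {v} p with lookup X v in eq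
... | true = lookup⇒[]= v X eq

∈⇒1 : ∀ {n} {X : Subset n} {v} → v ∈ X → indicator X v ≡ 1
∈⇒1 v∈X = cong bit ([]=⇒lookup v∈X)

∉⇒0 : ∀ {n} {X : Subset n} {v} → v ∉ X → indicator X v ≡ 0
∉⇒0 {X = X} {v} v∉X with lookup X v in eq
... | true  = contradiction (lookup⇒[]= v X eq) v∉X
... | false = refl

∈⇒pos : ∀ {n} {X : Subset n} {v} → v ∈ X → 0 < indicator X v
∈⇒pos v∈X = subst (0 <_) (sym (∈⇒1 v∈X)) z<s

≡-bits : ∀ {a b} → a ≤ 1 → b ≤ 1 → (0 < a → 0 < b) → (0 < b → 0 < a) → a ≡ b
≡-bits {zero}        {zero}        _ _ f g = refl
≡-bits {zero}        {suc _}       _ _ f g = contradiction (g z<s) λ ()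
≡-bits {suc _}       {zero}        _ _ f g = contradiction (f z<s) λ ()
≡-bits {suc .0} {suc .0} (s≤s z≤n) (s≤s z≤n) f g = refl

truth : ∀ {P : Set} → Dec P → ℕ
truth P? = bit (does P?)

truth-≤1 : ∀ {P : Set} (P? : Dec P) → truth P? ≤ 1
truth-≤1 (yes _) = ≤-refl
truth-≤1 (no _)  = z≤n

truth-pos : ∀ {P : Set} (P? : Dec P) → P → 0 < truth P?
truth-pos P? p = subst (λ b → 0 < bit b) (sym (dec-true P? p)) z<s

truth-pos⁻¹ : ∀ {P : Set} (P? : Dec P) → 0 < truth P? → P
truth-pos⁻¹ (yes p) _ = p

¬¬-all : ∀ {n} {P : Fin n → Set} → (∀ i → ¬ ¬ P i) → ¬ ¬ (∀ i → P i)
¬¬-all {zero}  h k = k λ ()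
¬¬-all {suc n} h k = h zero λ p₀ → ¬¬-all (h ∘ suc) λ p → k λ { zero → p₀ ; (suc i) → p i }

sum-single : ∀ {n} (f : Fin n → ℕ) u → (∀ v → v ≢ u → f v ≡ 0) → sum f ≡ f u
sum-single f zero    z = trans (cong (f zero +_) (sum-zero λ v → z (suc v) λ ())) (+-identityʳ _)
sum-single f (suc u) z = trans (cong (_+ sum (f ∘ suc)) (z zero λ ()))
  (sum-single (f ∘ suc) u λ v v≢u → z (suc v) (v≢u ∘ Fin.suc-injective))

+-positive : ∀ a {b} → 0 < a + b → 0 < a ⊎ 0 < b
+-positive zero    p = inj₂ p
+-positive (suc a) p = inj₁ z<s

¬pos⇒≡0 : ∀ {a} → ¬ (0 < a) → a ≡ 0
¬pos⇒≡0 h = n≤0⇒n≡0 (≮⇒≥ h)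

≡0⇒¬pos : ∀ {a} → a ≡ 0 → ¬ (0 < a)
≡0⇒¬pos refl ()

-- Walks and components of `G - S`

module _ {n} (G : Graph n) where
  open Graph G renaming (sym to adj-sym)

  ~-sym : ∀ {u v} → u ~ v → v ~ u
  ~-sym {u} {v} = subst T (adj-sym u v)

  module _ (S : Subset n) where

    reachable-sym : ∀ {u v} → Reachable G S u v → Reachable G S v u
    reachable-sym = reverse λ (u∉S , v∉S , u~v) → v∉S , u∉S , ~-sym u~v

    reachable-∉ : ∀ {u v} → Reachable G S u v → u ∉ S → v ∉ S
    reachable-∉ ε                      u∉S = u∉S
    reachable-∉ ((_ , v∉S , _) ◅ path) _   = reachable-∉ path v∉S

    -- Decidable reachability is available classically, which is enough for negative goals.
    ¬¬-decide : ¬ ¬ (∀ u v → Dec (Reachable G S u v))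
    ¬¬-decide = ¬¬-all λ u → ¬¬-all λ v → ¬¬-excluded-middle

    component-≡ : ∀ {D D′ u} → Component G S D → Component G S D′ → u ∈ D → u ∈ D′ → D ≡ D′
    component-≡ {D} {D′} {u} K K′ u∈D u∈D′ = ⊆-antisym
      (λ {v} v∈D → Equivalence.from (Component.class K′ u∈D′ v)
          (Equivalence.to (Component.class K u∈D v) v∈D))
      (λ {v} v∈D′ → Equivalence.from (Component.class K u∈D v)
          (Equivalence.to (Component.class K′ u∈D′ v) v∈D′))

    module _ (reach? : ∀ u v → Dec (Reachable G S u v)) where

      componentOf : Fin n → Subset n
      componentOf u = tabulate λ v → does (reach? u v)

      indicator-componentOf : ∀ u v → indicator (componentOf u) v ≡ truth (reach? u v)
      indicator-componentOf u v = cong bit (lookup∘tabulate (λ v → does (reach? u v)) v)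

      ∈-componentOf : ∀ {u v} → v ∈ componentOf u ⇔ Reachable G S u v
      ∈-componentOf {u} {v} = mk⇔
        (λ v∈ → truth-pos⁻¹ (reach? u v) (subst (0 <_) (indicator-componentOf u v) (∈⇒pos v∈)))
        (λ r → pos⇒∈ (subst (0 <_) (sym (indicator-componentOf u v)) (truth-pos (reach? u v) r)))

      componentOf-component : ∀ {u} → u ∉ S → Component G S (componentOf u)
      componentOf-component {u} u∉S = record
        { nonempty = u , Equivalence.from ∈-componentOf ε
        ; avoids = λ v∈ → x∉p⇒x∈∁p (reachable-∉ (Equivalence.to ∈-componentOf v∈) u∉S)
        ; class = λ u′∈ v → let r = Equivalence.to ∈-componentOf u′∈ in mk⇔
            (λ v∈ → reachable-sym r ◅◅ Equivalence.to ∈-componentOf v∈)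
            (λ r′ → Equivalence.from ∈-componentOf (r ◅◅ r′)) }

module Feasibility (I : Instance) where
  open Instance I
  open Partitions I
  open Graph G using (_~_)

  weight-value : ∀ X → weight w X ≡ value (indicator X)
  weight-value X = go (λ v → v)
    where
    -- `allFin n` is a `tabulate`, so the induction generalises the identity to an arbitrary `f`.
    go : ∀ {m} (f : Fin m → Fin n) →
      ListAction.sum (List.map w (List.filter (_∈? X) (List.tabulate f))) ≡
        sum (λ i → indicator X (f i) * w (f i))
    go {zero}  f = refl
    go {suc m} f with f zero ∈? X
    ... | yes p rewrite ∈⇒1 p = cong₂ _+_ (sym (+-identityʳ _)) (go (f ∘ suc))
    ... | no ¬p rewrite ∉⇒0 ¬p = go (f ∘ suc)

  excess-≤ : ∀ k → excess k ≡ 0 → ℤ.+ k ℤ.≤ wmax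
  excess-≤ k eq with wmax
  ... | ℤ.+ a = ℤ.+≤+ (m∸n≡0⇒m≤n eq)

  ≤-excess : ∀ k → ℤ.+ k ℤ.≤ wmax → excess k ≡ 0
  ≤-excess k le with wmax
  ≤-excess k (ℤ.+≤+ k≤a) | ℤ.+ a = m≤n⇒m∸n≡0 k≤a

  excess-mono : ∀ {k l} → k ≤ l → excess l ≡ 0 → excess k ≡ 0
  excess-mono {k} k≤l eq = n≤0⇒n≡0
      (subst (excess k ≤_) eq (+-monoʳ-≤ (signBit wmax) (∸-monoˡ-≤ ∣ wmax ∣ k≤l)))

  e-pos : ∀ {v u} → v ~ u → 0 < e v u
  e-pos {v} {u} v~u with Graph.adj G v u
  ... | true = z<s

  pos-e : ∀ {v u} → 0 < e v u → v ~ u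
  pos-e {v} {u} p with Graph.adj G v u
  ... | true = tt

  e-≤1 : ∀ v u → e v u ≤ 1
  e-≤1 v u with Graph.adj G v u
  ... | true  = ≤-refl
  ... | false = z≤n

  cover : ∀ {v u} → v ∉ C → v ~ u → u ∈ C
  cover v∉C v~u = [ (λ v∈C → contradiction v∈C v∉C) , (λ u∈C → u∈C) ]′ (C-cover _ _ v~u)

  outside-zero : ∀ {X v u} → outside X v ≡ 0 → v ~ u → u ∈ C → 0 < X u
  outside-zero {X} {v} {u} eq v~u u∈C = helper (e-pos v~u) (∈⇒1 u∈C)
      (sum-zero⁻¹ (λ u → (e v u + (c u ∸ X u)) ∸ 1) eq u)
    where
    helper : ∀ {a b x} → 0 < a → b ≡ 1 → (a + (b ∸ x)) ∸ 1 ≡ 0 → 0 < x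
    helper {suc a} {x = zero}  _ refl eq = contradiction (trans (sym (+-comm a 1)) eq) λ ()
    helper {suc a} {x = suc x} _ refl eq = z<s

  zero-outside : ∀ {X v} → (∀ u → v ~ u → u ∈ C → 0 < X u) → outside X v ≡ 0
  zero-outside {X} {v} h = sum-zero λ u →
    helper (e-≤1 v u) (indicator-≤1 C u) λ e> c> → h u (pos-e e>) (pos⇒∈ c>)
    where
    helper : ∀ {a b x} → a ≤ 1 → b ≤ 1 → (0 < a → 0 < b → 0 < x) → (a + (b ∸ x)) ∸ 1 ≡ 0
    helper {b = b} {x} z≤n b≤1 h = m≤n⇒m∸n≡0 (≤-trans (m∸n≤m b x) b≤1)
    helper {b = zero}  {x}     (s≤s z≤n) b≤1 h = 0∸n≡0 x
    helper {b = suc .0} {zero}  (s≤s z≤n) (s≤s z≤n) h = contradiction (h z<s z<s) λ ()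
    helper {b = suc .0} {suc x} (s≤s z≤n) (s≤s z≤n) h = 0∸n≡0 x

  inside-pos : ∀ {X v} → (∀ u → X u ≤ 1) → 0 < inside X v → ∃[ u ] v ~ u × 0 < X u
  inside-pos {X} {v} X≤1 p with sum-positive (λ u → (e v u + X u) ∸ 1) p
  ... | u , q = u , pos-e (proj₁ (helper (e-≤1 v u) (X≤1 u) q)) , proj₂ (helper (e-≤1 v u) (X≤1 u) q)
    where
    helper : ∀ {a x} → a ≤ 1 → x ≤ 1 → 0 < (a + x) ∸ 1 → 0 < a × 0 < x
    helper z≤n       (s≤s z≤n) ()
    helper (s≤s z≤n) (s≤s z≤n) _ = z<s , z<s

  pos-inside : ∀ {X v u} → v ~ u → 0 < X u → 0 < inside X v
  pos-inside {X} {v} {u} v~u p = sum-positive⁻¹ (λ u → (e v u + X u) ∸ 1) u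
      (m<n⇒0<n∸m (+-mono-≤ (e-pos v~u) p))

  module _ {X : Row} (X≤c : ∀ v → X v ≤ c v) where

    X≤1 : ∀ v → X v ≤ 1
    X≤1 v = ≤-trans (X≤c v) (indicator-≤1 C v)

    X⊆C : ∀ {v} → 0 < X v → v ∈ C
    X⊆C {v} p = pos⇒∈ (≤-trans p (X≤c v))

    closure-∈ : ∀ {v} → v ∈ C → closure X v ≡ X v
    closure-∈ {v} v∈C = trans (cong (X v +_) (trans (cong (f ∸_) (∈⇒1 v∈C))
      (m≤n⇒m∸n≡0 (≤-trans (m∸n≤m _ (outside X v)) (m∸n≤m 1 (1 ∸ inside X v)))))) (+-identityʳ _)
      where f = (1 ∸ (1 ∸ inside X v)) ∸ outside X v

    closure-∉ : ∀ {v} → v ∉ C → 0 < closure X v → 0 < inside X v × outside X v ≡ 0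
    closure-∉ {v} v∉C p = helper (n≤0⇒n≡0 (subst (X v ≤_) (∉⇒0 v∉C) (X≤c v))) (∉⇒0 v∉C) p
      where
      helper : ∀ {x i o c} → x ≡ 0 → c ≡ 0 → 0 < x + (((1 ∸ (1 ∸ i)) ∸ o) ∸ c) → 0 < i × o ≡ 0
      helper {i = suc i} {zero}  refl refl p = z<s , refl
      helper {i = zero}  {zero}  refl refl ()
      helper {i = zero}  {suc o} refl refl ()
      helper {i = suc i} {suc o} refl refl p rewrite 0∸n≡0 i | 0∸n≡0 o = contradiction p λ ()

    ∉-closure : ∀ {v} → v ∉ C → 0 < inside X v → outside X v ≡ 0 → 0 < closure X v
    ∉-closure {v} v∉C p eq = helper p eq (∉⇒0 v∉C)
      where
      helper : ∀ {x i o c} → 0 < i → o ≡ 0 → c ≡ 0 → 0 < x + (((1 ∸ (1 ∸ i)) ∸ o) ∸ c)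
      helper {x} {suc i} _ refl refl rewrite 0∸n≡0 i = m≤n+m 1 x

  -- Outside `C` this is the definition of the closure; in `C` it is the absence of edges leaving
  -- the block.
  closure-neighbours : ∀ {X v u} → Block X → 0 < closure X v → v ~ u → u ∈ C → 0 < X u
  closure-neighbours {X} {v} b p v~u u∈C with v ∈? C
  ... | no v∉C  = outside-zero {X} (proj₂ (closure-∉ (Block.≤c b) v∉C p)) v~u u∈C
  ... | yes v∈C = outside-zero {X} (helper (subst (0 <_) (closure-∈ (Block.≤c b) v∈C) p)
      (sum-zero⁻¹ (λ v → guard (X v) (outside X v)) (Block.closed b) v)) v~u u∈C
    where
    helper : ∀ {a k} → 0 < a → guard a k ≡ 0 → k ≡ 0
    helper {suc a} _ eq = eq

  isolated-≤1 : ∀ v → isolated v ≤ 1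
  isolated-≤1 v = ≤-trans (m∸n≤m (1 ∸ c v) (sum (e v))) (m∸n≤m 1 (c v))

  isolated-∉ : ∀ {v} → 0 < isolated v → v ∉ C
  isolated-∉ {v} p v∈C = ≡0⇒¬pos (trans (cong (λ k → (1 ∸ k) ∸ sum (e v)) (∈⇒1 v∈C)) (0∸n≡0 (sum (e v)))) p

  isolated-≁ : ∀ {v u} → 0 < isolated v → ¬ v ~ u
  isolated-≁ {v} {u} p v~u = ≡0⇒¬pos
      (m≤n⇒m∸n≡0 (≤-trans (m∸n≤m 1 (c v)) (sum-positive⁻¹ (e v) u (e-pos v~u)))) p

  ∉-isolated : ∀ {v} → v ∉ C → (∀ u → ¬ v ~ u) → 0 < isolated v
  ∉-isolated {v} v∉C none = subst (0 <_) (sym (cong₂ (λ a b → (1 ∸ a) ∸ b) (∉⇒0 v∉C)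
    (sum-zero {f = e v} λ u → ¬pos⇒≡0 λ p → none u (pos-e p)))) z<s

  isolated-light : isolatedExcess ≡ 0 → ∀ {v} → 0 < isolated v → excess (w v) ≡ 0
  isolated-light eq {v} p = helper p (sum-zero⁻¹ (λ v → guard (isolated v) (excess (w v))) eq v)
    where
    helper : ∀ {a k} → 0 < a → guard a k ≡ 0 → k ≡ 0
    helper {suc a} _ eq = eq

  -- From partitions to feasible sets.

  record BlockAround (Y K : Row) (v : Fin n) : Set where
    field
      {X}       : Row
      good      : Block X
      X⊆Y       : ∀ u → X u ≤ Y u
      v∈closure : 0 < closure X v
      closure⊆K : ∀ u → 0 < closure X u → 0 < K u
      absorbs   : ∀ {u t} → 0 < K u → u ~ t → 0 < X t → 0 < closure X u

  -- `Y ≤ c` forces the blocks to be disjoint. A kept vertex adjacent to some `t` in `X` is not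
  -- isolated, and it was not kept for another block, since that block would contain its neighbour
  -- `t` too; so it lies in the closure of `X`.
  blockAround : ∀ {r Y K} → Partition r Y K → (∀ v → Y v ≤ c v) → ∀ {v} → 0 < K v →
    0 < isolated v ⊎ BlockAround Y K v
  blockAround (empty _ _ k≡) Y≤c {v} p = inj₁ (subst (0 <_) (k≡ v) p)
  blockAround {Y = Y} {K} (add {X = X} {Z = Z} {J = J} b part y≡ k≡) Y≤c {v} p
    with +-positive (closure X v) (subst (0 <_) (k≡ v) p)
  ... | inj₁ q = inj₂ record
    { good = b
    ; X⊆Y = λ u → subst (X u ≤_) (sym (y≡ u)) (m≤m+n (X u) (Z u))
    ; v∈closure = q
    ; closure⊆K = λ u p → subst (0 <_) (sym (k≡ u)) (≤-trans p (m≤m+n _ _))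
    ; absorbs = absorbs }
    where
    absorbs : ∀ {u t} → 0 < K u → u ~ t → 0 < X t → 0 < closure X u
    absorbs {u} {t} p u~t q with +-positive (closure X u) (subst (0 <_) (k≡ u) p)
    ... | inj₁ p′ = p′
    ... | inj₂ p′ with blockAround part
        (λ v → ≤-trans (subst (Z v ≤_) (sym (y≡ v)) (m≤n+m (Z v) (X v))) (Y≤c v)) p′
    ... | inj₁ i = contradiction u~t (isolated-≁ i)
    ... | inj₂ B = contradiction
      (+-mono-≤ q (≤-trans (closure-neighbours (BlockAround.good B) (BlockAround.v∈closure B) u~t
          (X⊆C (Block.≤c b) q)) (BlockAround.X⊆Y B t)))
      (<⇒≱ (s≤s (≤-trans (subst (_≤ c t) (y≡ t) (Y≤c t)) (indicator-≤1 C t))))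
  ... | inj₂ q with blockAround part
      (λ v → ≤-trans (subst (Z v ≤_) (sym (y≡ v)) (m≤n+m (Z v) (X v))) (Y≤c v)) q
  ... | inj₁ i = inj₁ i
  ... | inj₂ B = inj₂ record
    { good = B.good
    ; X⊆Y = λ u → ≤-trans (B.X⊆Y u) (subst (Z u ≤_) (sym (y≡ u)) (m≤n+m (Z u) (X u)))
    ; v∈closure = B.v∈closure
    ; closure⊆K = λ u p → subst (0 <_) (sym (k≡ u)) (≤-trans (B.closure⊆K u p) (m≤n+m _ _))
    ; absorbs = absorbs }
    where
    module B = BlockAround B
    absorbs : ∀ {u t} → 0 < K u → u ~ t → 0 < B.X t → 0 < closure B.X u
    absorbs {u} {t} p u~t q with +-positive (closure X u) (subst (0 <_) (k≡ u) p)
    ... | inj₂ p′ = B.absorbs p′ u~t q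
    ... | inj₁ p′ = contradiction
      (+-mono-≤ (closure-neighbours b p′ u~t (X⊆C (Block.≤c B.good) q)) (≤-trans q (B.X⊆Y t)))
      (<⇒≱ (s≤s (≤-trans (subst (_≤ c t) (y≡ t) (Y≤c t)) (indicator-≤1 C t))))

  partition-∈ : ∀ {r Y K} → Partition r Y K → ∀ {v} → v ∈ C → K v ≡ Y v
  partition-∈ (empty _ y≡ k≡) {v} v∈C = trans (k≡ v) (trans (¬pos⇒≡0 λ p → isolated-∉ p v∈C) (sym (y≡ v)))
  partition-∈ (add b p y≡ k≡) {v} v∈C =
    trans (k≡ v) (trans (cong₂ _+_ (closure-∈ (Block.≤c b) v∈C) (partition-∈ p v∈C)) (sym (y≡ v)))

  isolated-≤K : ∀ {r Y K} → Partition r Y K → ∀ v → isolated v ≤ K v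
  isolated-≤K (empty _ _ k≡) v = ≤-reflexive (sym (k≡ v))
  isolated-≤K (add b p _ k≡) v = ≤-trans (isolated-≤K p v) (subst (_ ≤_) (sym (k≡ v)) (m≤n+m _ _))

  isolatedExcess-zero : ∀ {r Y K} → Partition r Y K → isolatedExcess ≡ 0
  isolatedExcess-zero (empty eq _ _) = eq
  isolatedExcess-zero (add _ p _ _)  = isolatedExcess-zero p

  -- A vertex outside `C` that is in a closure has a neighbour in that block, and
  -- `closure-neighbours` would put this neighbour into any second block as well. This is why
  -- closures demand a neighbour: otherwise an isolated vertex would lie in all of them.
  partition-≤1 : ∀ {r Y K} → Partition r Y K → (∀ v → Y v ≤ c v) → ∀ v → K v ≤ 1
  partition-≤1 (empty _ _ k≡) Y≤c v = subst (_≤ 1) (sym (k≡ v)) (isolated-≤1 v)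
  partition-≤1 {Y = Y} (add {X = X} {Z = Z} {J = J} b p y≡ k≡) Y≤c v = subst (_≤ 1) (sym (k≡ v))
    (helper (closure-≤1 (Block.≤c b) v) (partition-≤1 p Z≤c v) disjoint)
    where
    Z≤c : ∀ v → Z v ≤ c v
    Z≤c v = ≤-trans (subst (Z v ≤_) (sym (y≡ v)) (m≤n+m (Z v) (X v))) (Y≤c v)
    not-both : ∀ u → 0 < X u → ¬ (0 < Z u)
    not-both u p q = <⇒≱ (s≤s (≤-trans (subst (_≤ c u) (y≡ u) (Y≤c u)) (indicator-≤1 C u))) (+-mono-≤ p q)
    disjoint : 0 < closure X v → ¬ (0 < J v)
    disjoint p₁ p₂ with v ∈? C
    ... | yes v∈C = not-both v (subst (0 <_) (closure-∈ (Block.≤c b) v∈C) p₁)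
        (subst (0 <_) (partition-∈ p v∈C) p₂)
    ... | no v∉C with inside-pos {X} (X≤1 (Block.≤c b)) (proj₁ (closure-∉ (Block.≤c b) v∉C p₁))
        | blockAround p Z≤c p₂
    ... | u , v~u , q | inj₁ i = isolated-≁ i v~u
    ... | u , v~u , q | inj₂ B = not-both u q
      (≤-trans (closure-neighbours (BlockAround.good B) (BlockAround.v∈closure B) v~u (cover v∉C v~u))
          (BlockAround.X⊆Y B u))
    helper : ∀ {a b} → a ≤ 1 → b ≤ 1 → (0 < a → ¬ (0 < b)) → a + b ≤ 1
    helper z≤n       b≤1       _ = b≤1
    helper (s≤s z≤n) z≤n       _ = ≤-refl
    helper (s≤s z≤n) (s≤s z≤n) h = contradiction z<s (h z<s)

  isZero : ℕ → Bool
  isZero zero    = true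
  isZero (suc _) = false

  removed : Row → Subset n
  removed K = tabulate (isZero ∘ K)

  indicator-removed : ∀ K v → indicator (removed K) v ≡ 1 ∸ K v
  indicator-removed K v = trans (cong bit (lookup∘tabulate (isZero ∘ K) v)) (helper (K v))
    where
    helper : ∀ k → bit (isZero k) ≡ 1 ∸ k
    helper zero    = refl
    helper (suc k) = sym (0∸n≡0 k)

  module _ {r K} (p : Partition r c K) where

    private S = removed K

    ∈-removed : ∀ {v} → v ∈ S → K v ≡ 0
    ∈-removed {v} v∈S = helper (subst (0 <_) (indicator-removed K v) (∈⇒pos v∈S))
      where
      helper : ∀ {k} → 0 < 1 ∸ k → k ≡ 0
      helper {zero}  _ = refl
      helper {suc k} p = contradiction p (≡0⇒¬pos (0∸n≡0 k))

    ∉-removed : ∀ {v} → v ∉ S → 0 < K v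
    ∉-removed {v} v∉S = helper (trans (sym (indicator-removed K v)) (∉⇒0 v∉S))
      where
      helper : ∀ {k} → 1 ∸ k ≡ 0 → 0 < k
      helper {suc k} _ = z<s

    C-kept : ∀ {v} → v ∈ C → 0 < K v
    C-kept v∈C = subst (0 <_) (sym (partition-∈ p v∈C)) (∈⇒pos v∈C)

    kept-∉ : ∀ {v} → 0 < K v → v ∉ S
    kept-∉ q v∈S = ≡0⇒¬pos (∈-removed v∈S) q

    -- The vertex cover provides an end of the edge in `C`. If it is `u`, then `u` lies in the
    -- block, which absorbs `t`; if it is `t`, then `t` is in the block by `closure-neighbours`.
    closure-step : ∀ {v u} (B : BlockAround c K v) → 0 < closure (BlockAround.X B) u → ∀ {t} →
      u ~ t → 0 < K t → 0 < closure (BlockAround.X B) t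
    closure-step B q {t} u~t k with _ ∈? C
    ... | yes u∈C = absorbs k (~-sym G u~t) (subst (0 <_) (closure-∈ (Block.≤c good) u∈C) q)
      where open BlockAround B
    ... | no u∉C = subst (0 <_) (sym (closure-∈ (Block.≤c good) t∈C)) (closure-neighbours good q u~t t∈C)
      where
      open BlockAround B
      t∈C = cover u∉C u~t

    closure-reachable : ∀ {v u t} (B : BlockAround c K v) → 0 < closure (BlockAround.X B) u →
      Reachable G S u t → 0 < closure (BlockAround.X B) t
    closure-reachable B q ε = q
    closure-reachable B q ((_ , x∉S , u~x) ◅ path) =
      closure-reachable B (closure-step B q u~x (∉-removed x∉S)) path

    -- A removed vertex has a neighbour, isolated vertices being kept. If it were redundant, all its
    -- neighbours would lie in one component, hence in one closure and, as members of `C`, in one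
    -- block; then it would lie in the closure itself and be kept.
    removed-irredundant : Irredundant G S
    removed-irredundant v v∈S red = ¬¬-decide G S λ reach? → absurd reach?
      where
      v∉C : v ∉ C
      v∉C v∈C = kept-∉ (C-kept v∈C) v∈S
      module _ (reach? : ∀ u t → Dec (Reachable G S u t)) where
        u-edge : ∃[ u ] v ~ u
        u-edge with any? (λ u → 0 <? e v u)
        ... | yes (u , q) = u , pos-e q
        ... | no none = contradiction v∈S
            (kept-∉ (≤-trans (∉-isolated v∉C λ u v~u → none (u , e-pos v~u)) (isolated-≤K p v)))
        u = proj₁ u-edge
        v~u = proj₂ u-edge
        kept : ∀ {t} → v ~ t → 0 < K t
        kept v~t = C-kept (cover v∉C v~t)
        comp : ∀ {t} → v ~ t → Component G S (componentOf G S reach? t)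
        comp v~t = componentOf-component G S reach? (kept-∉ (kept v~t))
        self : ∀ {t} → v ~ t → HasNeighbourIn G v (componentOf G S reach? t)
        self {t} v~t = t , Equivalence.from (∈-componentOf G S reach?) ε , v~t
        absurd : _
        absurd with blockAround p (λ _ → ≤-refl) (kept v~u)
        ... | inj₁ i = isolated-≁ i (~-sym G v~u)
        ... | inj₂ B = kept-∉ (closure⊆K v (∉-closure (Block.≤c good) v∉C (pos-inside {X} v~u (all-in v~u))
                (zero-outside {X} λ t v~t _ → all-in v~t))) v∈S
          where
          open BlockAround B
          all-in : ∀ {t} → v ~ t → 0 < X t
          all-in {t} v~t = subst (0 <_) (closure-∈ (Block.≤c good) (cover v∉C v~t))
            (closure-reachable B v∈closure (Equivalence.to (∈-componentOf G S reach?)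
              (subst (t ∈_) (red _ _ (comp v~t) (comp v~u) (self v~t) (self v~u))
                  (proj₁ (proj₂ (self v~t))))))

    -- `light` bounds the whole closure, of which `D` may be a proper part. The component of an
    -- isolated vertex is tested by `isolatedExcess` instead.
    removed-light : ∀ D → Component G S D → ℤ.+ weight w D ℤ.≤ wmax
    removed-light D comp = excess-≤ _ (go nonempty)
      where
      open Component comp
      go : Nonempty D → excess (weight w D) ≡ 0
      go (u , u∈D) with blockAround p (λ _ → ≤-refl) (∉-removed (x∈∁p⇒x∉p (avoids u∈D)))
      ... | inj₁ i = trans (cong excess eq) (isolated-light (isolatedExcess-zero p) i)
        where
        alone : ∀ {v} → Reachable G S u v → v ≡ u
        alone ε = refl
        alone ((_ , _ , u~x) ◅ _) = contradiction u~x (isolated-≁ i)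
        eq : weight w D ≡ w u
        eq = trans (weight-value D) (trans
          (sum-single (λ v → indicator D v * w v) u λ v v≢u →
            cong (_* w v) (∉⇒0 λ v∈D → v≢u (alone (Equivalence.to (class u∈D v) v∈D))))
          (trans (cong (_* w u) (∈⇒1 u∈D)) (+-identityʳ _)))
      ... | inj₂ B = excess-mono (subst (_≤ heaviness X) (sym (weight-value D)) (sum-mono term))
          (Block.light good)
        where
        open BlockAround B
        term : ∀ v → indicator D v * w v ≤ guard (closure X v) (w v)
        term v with v ∈? D
        ... | no v∉D = subst (λ k → k * w v ≤ guard (closure X v) (w v)) (sym (∉⇒0 v∉D)) z≤n
        ... | yes v∈D = helper (∈⇒1 v∈D) (closure-reachable B v∈closure (Equivalence.to (class u∈D v) v∈D))
          where
          helper : ∀ {a b k} → a ≡ 1 → 0 < b → a * k ≤ guard b k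
          helper {b = suc b} refl _ = ≤-reflexive (+-identityʳ _)

    removed-feasible : Feasible I S
    removed-feasible =
      (λ v∈S → x∉p⇒x∈∁p λ v∈C → kept-∉ (C-kept v∈C) v∈S) , removed-irredundant , removed-light

  value-complement : ∀ {A K : Row} → (∀ v → A v + K v ≡ 1) → value A + value K ≡ value (λ _ → 1)
  value-complement {A} {K} eq = sym (value-+ {X = A} {K} (λ v → sym (eq v)))

  -- From feasible sets to partitions: the blocks are the traces on C of the
  -- components of G - S that meet C, listed by their first vertex in C.

  module _ {S : Subset n} (feasible : Feasible I S) (reach? : ∀ u v → Dec (Reachable G S u v)) where

    private
      S⊆ : S ⊆ ∁ C
      S⊆ = proj₁ feasible
      irredundant : Irredundant G S
      irredundant = proj₁ (proj₂ feasible)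
      comp-light : ∀ D → Component G S D → excess (weight w D) ≡ 0
      comp-light D K = ≤-excess _ (proj₂ (proj₂ feasible) D K)

    C∩S : ∀ {v} → v ∈ C → v ∉ S
    C∩S v∈C v∈S = x∈∁p⇒x∉p (S⊆ v∈S) v∈C

    isolated-∉S : ∀ {v} → 0 < isolated v → v ∉ S
    isolated-∉S i v∈S = irredundant _ v∈S λ _ _ _ _ (_ , _ , v~u) → contradiction v~u (isolated-≁ i)

    no-isolatedExcess : isolatedExcess ≡ 0
    no-isolatedExcess = sum-zero term
      where
      term : ∀ v → guard (isolated v) (excess (w v)) ≡ 0
      term v with isolated v in eq
      ... | zero  = refl
      ... | suc _ = trans (cong excess (sym weight-v)) (comp-light D (componentOf-component G S reach? v∉S))
        where
        i : 0 < isolated v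
        i = subst (0 <_) (sym eq) z<s
        v∉S = isolated-∉S i
        D = componentOf G S reach? v
        alone : ∀ {u} → Reachable G S v u → u ≡ v
        alone ε = refl
        alone ((_ , _ , v~x) ◅ _) = contradiction v~x (isolated-≁ i)
        weight-v : weight w D ≡ w v
        weight-v = trans (weight-value D) (trans
          (sum-single (λ u → indicator D u * w u) v λ u u≢v →
            cong (_* w u) (∉⇒0 λ u∈D → u≢v (alone (Equivalence.to (∈-componentOf G S reach?) u∈D))))
          (trans (cong (_* w v) (∈⇒1 (Equivalence.from (∈-componentOf G S reach?) ε))) (+-identityʳ _)))

    Covered : ℕ → Fin n → Set
    Covered j v = ∃[ u ] toℕ u < j × u ∈ C × Reachable G S u v

    covered? : ∀ j v → Dec (Covered j v)
    covered? j v = any? λ u → toℕ u <? j ×-dec u ∈? C ×-dec reach? u v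

    cov : ℕ → Row
    cov j v = truth (covered? j v)

    last-edge : ∀ {u v} → Reachable G S u v → u ≡ v ⊎ ∃[ t ] Reachable G S u t × t ∉ S × v ∉ S × t ~ v
    last-edge ε = inj₁ refl
    last-edge (s@(u∉S , x∉S , u~x) ◅ path) with last-edge path
    ... | inj₁ refl             = inj₂ (_ , ε , u∉S , x∉S , u~x)
    ... | inj₂ (t , r , edge)   = inj₂ (t , s ◅ r , edge)

    module _ {u} (u∈C : u ∈ C) where

      trace : Row
      trace v = c v * truth (reach? u v)

      trace-≤c : ∀ v → trace v ≤ c v
      trace-≤c v = ≤-trans (*-monoʳ-≤ (c v) (truth-≤1 (reach? u v))) (≤-reflexive (*-identityʳ (c v)))

      trace-pos : ∀ {v} → v ∈ C → Reachable G S u v → 0 < trace v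
      trace-pos v∈C r = *-mono-≤ (∈⇒pos v∈C) (truth-pos (reach? u _) r)

      pos-trace : ∀ {v} → 0 < trace v → Reachable G S u v
      pos-trace {v} p with reach? u v
      ... | yes r = r
      ... | no _  = contradiction p (≡0⇒¬pos (*-zeroʳ (c v)))

      extend : ∀ {t v} → Reachable G S u t → t ~ v → v ∉ S → Reachable G S u v
      extend r t~v v∉S = r ◅◅ ((reachable-∉ G S r (C∩S u∈C) , v∉S , t~v) ◅ ε)

      -- Irredundancy enters here: if all neighbours of `v` outside `C` lie in the component of `u`,
      -- then every component with a neighbour of `v` contains `u`, so `v` cannot be in `S`.
      -- Conversely, a walk to such a kept `v` ends with an edge from `C`, and through `v` it
      -- reaches all other neighbours.
      closure-trace : ∀ v → closure trace v ≡ truth (reach? u v)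
      closure-trace v = ≡-bits (closure-≤1 trace-≤c v) (truth-≤1 (reach? u v)) forward backward
        where
        forward : 0 < closure trace v → 0 < truth (reach? u v)
        forward p with v ∈? C
        ... | yes v∈C = truth-pos (reach? u v) (pos-trace (subst (0 <_) (closure-∈ trace-≤c v∈C) p))
        ... | no v∉C with closure-∉ trace-≤c v∉C p
        ... | p-in , out≡0 with inside-pos {trace} (X≤1 trace-≤c) p-in
        ... | t , v~t , q = truth-pos (reach? u v) (extend (pos-trace q) (~-sym G v~t) v∉S)
          where
          near : ∀ {D} → Component G S D → HasNeighbourIn G v D → u ∈ D
          near K (x , x∈D , v~x) = Equivalence.from (Component.class K x∈D u)
            (reachable-sym G S (pos-trace (outside-zero {trace} out≡0 v~x (cover v∉C v~x))))
          v∉S : v ∉ S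
          v∉S v∈S = irredundant v v∈S λ D D′ K K′ h h′ → component-≡ G S K K′ (near K h) (near K′ h′)
        backward : 0 < truth (reach? u v) → 0 < closure trace v
        backward p with v ∈? C
        ... | yes v∈C = subst (0 <_) (sym (closure-∈ trace-≤c v∈C))
            (trace-pos v∈C (truth-pos⁻¹ (reach? u v) p))
        ... | no v∉C with last-edge (truth-pos⁻¹ (reach? u v) p)
        ... | inj₁ refl = contradiction u∈C v∉C
        ... | inj₂ (t , r , t∉S , v∉S , t~v) = ∉-closure trace-≤c v∉C
          (pos-inside {trace} (~-sym G t~v) (trace-pos (cover v∉C (~-sym G t~v)) r))
          (zero-outside {trace} λ x v~x x∈C → trace-pos x∈C
              (extend (truth-pos⁻¹ (reach? u v) p) v~x (C∩S x∈C)))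

      trace-block : Block trace
      trace-block = record
        { ≤c = trace-≤c
        ; closed = sum-zero term
        ; light = trans (cong excess heavy) (comp-light D (componentOf-component G S reach? (C∩S u∈C))) }
        where
        D = componentOf G S reach? u
        heavy : heaviness trace ≡ weight w D
        heavy = trans (heaviness-value {trace} trace-≤c) (trans
          (sum-cong-≗ λ v → cong (_* w v)
              (trans (closure-trace v) (sym (indicator-componentOf G S reach? u v))))
          (sym (weight-value D)))
        term : ∀ v → guard (trace v) (outside trace v) ≡ 0
        term v with trace v in eq
        ... | zero  = refl
        ... | suc _ = zero-outside {trace} λ t v~t t∈C →
          trace-pos t∈C (extend (pos-trace (subst (0 <_) (sym eq) z<s)) v~t (C∩S t∈C))

    traced kept : ℕ → Row
    traced j v = c v * cov j v
    kept j v   = isolated v + cov j v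

    -- The summands never overlap: an earlier vertex of `C` that reaches `v` in the component of `u`
    -- would reach `u` as well.
    cov-next : ∀ {u} → u ∈ C → ¬ Covered (toℕ u) u → ∀ v →
      cov (suc (toℕ u)) v ≡ truth (reach? u v) + cov (toℕ u) v
    cov-next {u} u∈C new v with reach? u v
    ... | yes r = trans (≡-bits (truth-≤1 (covered? (suc (toℕ u)) v)) ≤-refl (λ _ → z<s)
                    (λ _ → truth-pos (covered? (suc (toℕ u)) v) (u , ≤-refl , u∈C , r)))
                    (cong (1 +_) (sym (cong bit (dec-false (covered? (toℕ u) v) λ (t , t< , t∈C , r′) →
                      new (t , t< , t∈C , r′ ◅◅ reachable-sym G S r)))))
    ... | no ¬r = ≡-bits (truth-≤1 (covered? (suc (toℕ u)) v)) (truth-≤1 (covered? (toℕ u) v))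
      (λ p → truth-pos (covered? (toℕ u) v) (back (truth-pos⁻¹ (covered? (suc (toℕ u)) v) p)))
      (λ p → let (t , t< , h) = truth-pos⁻¹ (covered? (toℕ u) v) p in
             truth-pos (covered? (suc (toℕ u)) v) (t , m≤n⇒m≤1+n t< , h))
      where
      back : Covered (suc (toℕ u)) v → Covered (toℕ u) v
      back (t , t≤ , t∈C , r) = t , ≤∧≢⇒< (≤-pred t≤)
          (λ eq → ¬r (subst (λ x → Reachable G S x v) (toℕ-injective eq) r)) , t∈C , r

    cov-same : ∀ {u} → ¬ (u ∈ C × ¬ Covered (toℕ u) u) → ∀ v → cov (suc (toℕ u)) v ≡ cov (toℕ u) v
    cov-same {u} old v = ≡-bits (truth-≤1 (covered? (suc (toℕ u)) v)) (truth-≤1 (covered? (toℕ u) v))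
      (λ p → truth-pos (covered? (toℕ u) v) (back (truth-pos⁻¹ (covered? (suc (toℕ u)) v) p)))
      (λ p → let (t , t< , h) = truth-pos⁻¹ (covered? (toℕ u) v) p in
             truth-pos (covered? (suc (toℕ u)) v) (t , m≤n⇒m≤1+n t< , h))
      where
      back : Covered (suc (toℕ u)) v → Covered (toℕ u) v
      back (t , t≤ , t∈C , r) with toℕ t ≟ toℕ u
      ... | no t≢u = t , ≤∧≢⇒< (≤-pred t≤) t≢u , t∈C , r
      ... | yes t≡u with toℕ-injective t≡u
      ... | refl with covered? (toℕ u) u
      ... | yes (x , x< , x∈C , r′) = x , x< , x∈C , r′ ◅◅ r
      ... | no new = contradiction (t∈C , new) old

    -- Each vertex opens at most one block, namely if it is the first of `C` in its component. The
    -- bound `r ≤ j` is what limits the algorithm to `n` rounds.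
    partition-upto : ∀ j → j ≤ n → ∃[ r ] r ≤ j × Partition r (traced j) (kept j)
    partition-upto zero _ = 0 , z≤n , empty no-isolatedExcess
      (λ v → trans (cong (c v *_) (none v)) (*-zeroʳ (c v)))
      (λ v → trans (cong (isolated v +_) (none v)) (+-identityʳ _))
      where
      none : ∀ v → cov 0 v ≡ 0
      none v = cong bit (dec-false (covered? 0 v) λ ())
    -- Matching on `refl` replaces `j` by `toℕ u`, the position of the vertex under consideration.
    partition-upto (suc j) j<n with partition-upto j (<⇒≤ j<n) | fromℕ< j<n | toℕ-fromℕ< j<n
    ... | r , r≤j , p | u | refl with u ∈? C | covered? (toℕ u) u
    ... | yes u∈C | no new = suc r , s≤s r≤j , add (trace-block u∈C) p
        (λ v → trans (cong (c v *_) (cov-next u∈C new v)) (*-distribˡ-+ (c v) _ _))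
        (λ v → trans (cong (isolated v +_) (cov-next u∈C new v))
          (trans (+-x∙yz≈y∙xz (isolated v) (truth (reach? u v)) (cov (toℕ u) v))
            (cong (_+ kept (toℕ u) v) (sym (closure-trace u∈C v)))))
    ... | yes _   | yes old = r , m≤n⇒m≤1+n r≤j , partition-resp
        (λ v → cong (c v *_) (cov-same (λ (_ , new) → new old) v))
        (λ v → cong (isolated v +_) (cov-same (λ (_ , new) → new old) v)) p
    ... | no u∉C  | _ = r , m≤n⇒m≤1+n r≤j , partition-resp
        (λ v → cong (c v *_) (cov-same (λ (u∈C , _) → u∉C u∈C) v))
        (λ v → cong (isolated v +_) (cov-same (λ (u∈C , _) → u∉C u∈C) v)) p

    traced-all : ∀ v → c v ≡ traced n v
    traced-all v with v ∈? C
    ... | no v∉C  = trans (∉⇒0 v∉C) (cong (_* cov n v) (sym (∉⇒0 v∉C)))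
    ... | yes v∈C = sym (trans
        (cong (c v *_) (cong bit (dec-true (covered? n v) (v , toℕ<n v , v∈C , ε)))) (*-identityʳ (c v)))

    kept-all : ∀ v → indicator S v + kept n v ≡ 1
    kept-all v with v ∈? S
    ... | yes v∈S = cong₂ _+_ (∈⇒1 v∈S) (cong₂ _+_ (¬pos⇒≡0 λ i → isolated-∉S i v∈S)
            (cong bit (dec-false (covered? n v) λ (_ , _ , u∈C , r) → reachable-∉ G S r (C∩S u∈C) v∈S)))
    ... | no v∉S rewrite ∉⇒0 v∉S with any? (λ u → 0 <? e v u) | v ∈? C
    ... | _ | yes v∈C = cong₂ _+_ (¬pos⇒≡0 λ i → isolated-∉ i v∈C)
            (cong bit (dec-true (covered? n v) (v , toℕ<n v , v∈C , ε)))
    ... | yes (u , q) | no v∉C = cong₂ _+_ (¬pos⇒≡0 λ i → isolated-≁ i (pos-e q))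
            (cong bit (dec-true (covered? n v) (u , toℕ<n u , cover v∉C (pos-e q) ,
              (C∩S (cover v∉C (pos-e q)) , v∉S , ~-sym G (pos-e q)) ◅ ε)))
    ... | no none | no v∉C = cong₂ _+_
            (≡-bits (isolated-≤1 v) ≤-refl (λ _ → z<s)
                (λ _ → ∉-isolated v∉C λ u v~u → none (u , e-pos v~u)))
            (cong bit (dec-false (covered? n v) uncovered))
      where
      uncovered : ¬ Covered n v
      uncovered (u , _ , u∈C , r) with last-edge r
      ... | inj₁ refl = v∉C u∈C
      ... | inj₂ (t , _ , _ , _ , t~v) = none (t , e-pos (~-sym G t~v))

    feasible⇒partition : ∃[ r ] ∃[ K ] r ≤ n × Partition r c K × (∀ v → indicator S v + K v ≡ 1)
    feasible⇒partition with partition-upto n ≤-refl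
    ... | r , r≤n , p = r , kept n , r≤n , partition-resp traced-all (λ _ → refl) p , kept-all

  -- Removed and kept weight add up to the total weight, so keeping most means removing least. The
  -- comparison of two numbers is stable under double negation, so reachability in `G - S′` may be
  -- assumed decidable.
  optimal : ∀ {r K} → Partition r c K → (∀ {r′ K′} → r′ ≤ n → Partition r′ c K′ → value K′ ≤ value K) →
    Optimal I (removed K)
  optimal {K = K} p best = removed-feasible p , λ S′ f′ →
    decidable-stable (weight w S ≤? weight w S′) λ ¬le → ¬¬-decide G S′ λ reach? →
      ¬le (minimal S′ f′ reach?)
    where
    S = removed K
    complement : ∀ v → indicator S v + K v ≡ 1
    complement v = trans (cong (_+ K v) (indicator-removed K v)) (m∸n+n≡m (partition-≤1 p (λ _ → ≤-refl) v))
    minimal : ∀ S′ → Feasible I S′ → (∀ u v → Dec (Reachable G S′ u v)) → weight w S ≤ weight w S′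
    minimal S′ f′ reach? with feasible⇒partition f′ reach?
    ... | r′ , K′ , r′≤n , p′ , complement′ = +-cancelʳ-≤ (value K) _ _ (begin
      weight w S + value K                ≡⟨ cong (_+ value K) (weight-value S) ⟩
      value (indicator S) + value K       ≡⟨ value-complement {indicator S} {K} complement ⟩
      value (λ _ → 1)                     ≡⟨ value-complement {indicator S′} {K′} complement′ ⟨
      value (indicator S′) + value K′     ≡⟨ cong (_+ value K′) (weight-value S′) ⟨
      weight w S′ + value K′              ≤⟨ +-monoʳ-≤ (weight w S′) (best r′≤n p′) ⟩
      weight w S′ + value K               ∎)
      where open ≤-Reasoning

  infeasible : (∀ {r K} → r ≤ n → ¬ Partition r c K) → ∀ S → ¬ Feasible I S
  infeasible none S f = ¬¬-decide G S λ reach? →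
    let (_ , _ , r≤n , p , _) = feasible⇒partition f reach? in none r≤n p

-- The algorithm

-- Registers: 0 - 2 input, 3 the number of rows, 4 the number of subsets of C, 5 the
-- round, 6 - 8 rows x , y , z, 9 and 10 vertices, 11 - 15 accumulators.
-- Arrays: 0 - 2 input, 3 the rows (subsets of C), 4 the multiples of n, 5 the closure of
-- row x, 6 the halves ⌊ i /2⌋. For the best partition of row y found so far, array 8 holds
-- its union K of closures and array 7 holds 1 + value K - value isolated (0 if there is none).

edgeAt memberAt keptAt : ℕ → ℕ → Exp
edgeAt   v u = 2 [ 4 [ var v ] ⊕ var u ]
memberAt x v = 3 [ 4 [ var x ] ⊕ var v ]
keptAt   y v = 8 [ 4 [ var y ] ⊕ var v ]

excessOf : Exp → Exp
excessOf k = var 1 ⊕ (k ⊖ var 2)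

sumInto : ℕ → ℕ → Exp → Prog
sumInto s x e = s := lit 0 ▸ for x 0 (s := var s ⊕ e)

countSubsets multiples halves : Prog
countSubsets = 4 := lit 1 ▸ for 9 0 (when (1 [ var 9 ]) (4 := var 4 ⊕ var 4))
multiples = 15 := lit 0 ▸ for 6 3 (4 [ var 6 ]:= var 15 ▸ 15 := var 15 ⊕ var 0)
halves = for 6 3 (6 [ var 6 ⊕ lit 2 ]:= 6 [ var 6 ] ⊕ lit 1)

writeDigit dropDigit digits rows : Prog
writeDigit = 3 [ 4 [ var 6 ] ⊕ var 9 ]:=
  (1 [ var 9 ] ⊕ (var 15 ⊖ (6 [ var 15 ] ⊕ 6 [ var 15 ]))) ⊖ lit 1
dropDigit = when (1 [ var 9 ]) (15 := 6 [ var 15 ])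
digits = for 9 0 (writeDigit ▸ dropDigit)
rows = for 6 3 (15 := var 6 ▸ digits)

-- Row 0 codes the empty set and has address 0, so its cells in array 8 are indexed by the vertex
-- alone. Measuring values relative to `isolated` lets its entry in array 7 start at the constant 1,
-- or at 0 if an isolated vertex is too heavy.
degree markIsolated addExcess isolate start : Prog
degree = sumInto 11 10 (edgeAt 9 10)
markIsolated = 8 [ var 9 ]:= (lit 1 ⊖ 1 [ var 9 ]) ⊖ var 11
addExcess = when (8 [ var 9 ]) (14 := var 14 ⊕ excessOf (0 [ var 9 ]))
isolate = degree ▸ markIsolated ▸ addExcess
start = 14 := lit 0 ▸ for 9 0 isolate ▸ 7 [ lit 0 ]:= lit 1 ⊖ var 14

-- `mismatchTerm` is the distance between `y` and `x + z` at one vertex. As row `y` has entries at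
-- most 1, distance 0 everywhere also forces `x` and `z` to be disjoint.
insideTerm outsideTerm mismatchTerm : Exp
insideTerm   = (edgeAt 9 10 ⊕ memberAt 6 10) ⊖ lit 1
outsideTerm  = (edgeAt 9 10 ⊕ (1 [ var 10 ] ⊖ memberAt 6 10)) ⊖ lit 1
mismatchTerm = (memberAt 7 9 ⊖ (memberAt 6 9 ⊕ memberAt 8 9)) ⊕
               ((memberAt 6 9 ⊕ memberAt 8 9) ⊖ memberAt 7 9)

insideSum outsideSum closeVertex addWeight addLeak closeBody close : Prog
insideSum = sumInto 11 10 insideTerm
outsideSum = sumInto 12 10 outsideTerm
closeVertex = 5 [ var 9 ]:=
  memberAt 6 9 ⊕ (((lit 1 ⊖ (lit 1 ⊖ var 11)) ⊖ var 12) ⊖ 1 [ var 9 ])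
addWeight = when (5 [ var 9 ]) (13 := var 13 ⊕ 0 [ var 9 ])
addLeak = when (memberAt 6 9) (14 := var 14 ⊕ var 12)
closeBody = insideSum ▸ outsideSum ▸ closeVertex ▸ addWeight ▸ addLeak
close = 13 := lit 0 ▸ 14 := lit 0 ▸ for 9 0 closeBody ▸ 14 := var 14 ⊕ excessOf (var 13)

-- An entry of array 7 is replaced only by a strictly larger one. This monotonicity is what makes
-- updates in place harmless.
mergeBody merge setBest improve relax round rounds outputBody output : Prog
mergeBody = 8 [ 4 [ var 7 ] ⊕ var 9 ]:= 5 [ var 9 ] ⊕ keptAt 8 9
merge = for 9 0 mergeBody
setBest = 7 [ var 7 ]:= var 13 ⊕ 7 [ var 8 ]
improve = sumInto 11 9 mismatchTerm ▸ when (lit 1 ⊖ var 11) (setBest ▸ merge)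
relax = when (7 [ var 8 ]) (when ((var 13 ⊕ 7 [ var 8 ]) ⊖ 7 [ var 7 ]) improve)
round = for 6 3 (close ▸ when (lit 1 ⊖ var 14) (for 7 3 (for 8 3 relax)))
rounds = for 5 0 round
outputBody = 0 [ var 9 ]:= lit 1 ⊖ 8 [ 4 [ var 4 ⊖ lit 1 ] ⊕ var 9 ]
output = for 9 0 outputBody

prepare solve : Prog
prepare = multiples ▸ halves ▸ rows ▸ start
solve = prepare ▸ rounds ▸ output

flag : Exp
flag = lit 1 ⊖ (lit 1 ⊖ 7 [ var 4 ⊖ lit 1 ])

-- Loop programs may not assign the bounds in registers 0 and 3. So the two assignments to them
-- stand between and after the loop programs, and the first stage loops over vertices only.
algorithm : Cmd
algorithm = code countSubsets ⨾ 3 ≔ var 0 ⊕ var 4 ⨾ code solve ⨾ 0 ≔ flag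

-- Correctness of the program

toℕ-≮0 : ∀ {N} (i : Fin N) {A : Set} → toℕ i < 0 → A
toℕ-≮0 i ()

below-suc : ∀ {N} (P : Fin N → Set) (j : Fin N) → (∀ i → toℕ i < toℕ j → P i) → P j →
  ∀ i → toℕ i < suc (toℕ j) → P i
below-suc P j old new i i≤j with toℕ i ≟ toℕ j
... | yes i≡j = subst P (sym (toℕ-injective i≡j)) new
... | no  i≢j = old i (≤∧≢⇒< (≤-pred i≤j) i≢j)

sumInto-spec : ∀ s x e {n σ} (g : Fin n → ℕ) → reg σ 0 ≡ n → T (not (0 ≡ᵇ s)) →
  T (not (s ≡ᵇ x)) → T (not (x ≡ᵇ s)) →
  (∀ v τ → reg τ x ≡ toℕ v → Agree (sumInto s x e) σ τ → ⟦ e ⟧ τ ≡ g v) →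
  reg (run (sumInto s x e) σ) s ≡ sum g
sumInto-spec s x e {n} {σ} g eqn 0≢s s≢x x≢s val =
  trans (for-rule x 0 _ (λ i τ → reg τ s ≡ prefix g i) (trans (update-other (reg σ) {x = s} 0≢s) eqn) x≢s
    (trans (update-other (update (reg σ) s 0) {x = x} s≢x)
        (trans (update-≡ (reg σ) s) (sym (prefix-zero g))))
    λ v τ at a ih → trans (update-other (reg (run (s := var s ⊕ e) τ)) s≢x)
      (trans (update-≡ (reg τ) s)
        (trans (cong₂ _+_ ih (val v τ at (agree-after (s := lit 0) a))) (sym (prefix-suc g v)))))
    (prefix-all g)

module Correct (I : Instance) where
  open Instance I
  open Partitions I

  -- The n redundant rows make L a bound on every loop, and let the multiples of n
  -- also address the adjacency matrix.
  M L : ℕ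
  M = 2 ^ card C
  L = n + M

  -- Codes from `M` on decode as well, their digits beyond the first |C| being ignored; so every row
  -- is a subset of `C`.
  row : Fin L → Row
  row y = decode C (toℕ y)

  record Inputs (τ : Store) : Set where
    field
      n-reg    : reg τ 0 ≡ n
      sign-reg : reg τ 1 ≡ signBit wmax
      abs-reg  : reg τ 2 ≡ ∣ wmax ∣
      w-arr    : ∀ v → arr τ 0 (toℕ v) ≡ w v
      c-arr    : ∀ v → arr τ 1 (toℕ v) ≡ c v
      e-arr    : ∀ v u → arr τ 2 (at v u) ≡ e v u

  record Sizes (τ : Store) : Set where
    field
      inputs : Inputs τ
      L-reg  : reg τ 3 ≡ L
      M-reg  : reg τ 4 ≡ M
    open Inputs inputs public

  record Layout (τ : Store) : Set where
    field
      sizes    : Sizes τ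
      base-arr : ∀ (i : Fin L) → arr τ 4 (toℕ i) ≡ n * toℕ i
    open Sizes sizes public

  record Tables (τ : Store) : Set where
    field
      layout  : Layout τ
      row-arr : ∀ y v → arr τ 3 (at y v) ≡ row y v
    open Layout layout public

  -- Each layer of facts comes with the check of the cells it depends on, so carrying it past a
  -- concrete program costs one `_`.
  keepsInputs keepsSizes keepsLayout keepsTables : Prog → Bool
  keepsInputs p = keepsReg 0 p ∧ keepsReg 1 p ∧ keepsReg 2 p ∧ keepsArr 0 p ∧ keepsArr 1 p ∧ keepsArr 2 p
  keepsSizes p  = keepsReg 3 p ∧ keepsReg 4 p ∧ keepsInputs p
  keepsLayout p = keepsArr 4 p ∧ keepsSizes p
  keepsTables p = keepsArr 3 p ∧ keepsLayout p

  module _ {p σ τ} (a : Agree p σ τ) where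

    keep-inputs : T (keepsInputs p) → Inputs σ → Inputs τ
    keep-inputs k s with ∧-elim {keepsReg 0 p} k
    ... | k0 , k₁ with ∧-elim {keepsReg 1 p} k₁
    ... | k1 , k₂ with ∧-elim {keepsReg 2 p} k₂
    ... | k2 , k₃ with ∧-elim {keepsArr 0 p} k₃
    ... | a0 , k₄ with ∧-elim {keepsArr 1 p} k₄
    ... | a1 , a2 = record
      { n-reg = trans (regs a 0 k0) n-reg ; sign-reg = trans (regs a 1 k1) sign-reg
      ; abs-reg = trans (regs a 2 k2) abs-reg
      ; w-arr = λ v → trans (cong-app (arrs a 0 a0) _) (w-arr v)
      ; c-arr = λ v → trans (cong-app (arrs a 1 a1) _) (c-arr v)
      ; e-arr = λ v u → trans (cong-app (arrs a 2 a2) _) (e-arr v u) }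
      where open Inputs s

    keep-sizes : T (keepsSizes p) → Sizes σ → Sizes τ
    keep-sizes k s with ∧-elim {keepsReg 3 p} k
    ... | k3 , k₁ with ∧-elim {keepsReg 4 p} k₁
    ... | k4 , k₂ = record
      { inputs = keep-inputs k₂ inputs
      ; L-reg = trans (regs a 3 k3) L-reg
      ; M-reg = trans (regs a 4 k4) M-reg }
      where open Sizes s

    keep-layout : T (keepsLayout p) → Layout σ → Layout τ
    keep-layout k s with ∧-elim {keepsArr 4 p} k
    ... | k4 , k₁ = record
      { sizes = keep-sizes k₁ sizes ; base-arr = λ i → trans (cong-app (arrs a 4 k4) _) (base-arr i) }
      where open Layout s

    keep-tables : T (keepsTables p) → Tables σ → Tables τ
    keep-tables k s with ∧-elim {keepsArr 3 p} k
    ... | k3 , k₁ = record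
      { layout = keep-layout k₁ layout ; row-arr = λ y v → trans (cong-app (arrs a 3 k3) _) (row-arr y v) }
      where open Tables s

  module _ {τ} (s : Layout τ) where
    open Layout s

    eval-cell : ∀ {i j} (y : Fin L) (v : Fin n) → reg τ i ≡ toℕ y → reg τ j ≡ toℕ v →
      ⟦ 4 [ var i ] ⊕ var j ⟧ τ ≡ at y v
    eval-cell y v i≡ j≡ rewrite i≡ | j≡ | base-arr y = refl

    eval-edge : ∀ {i j} v u → reg τ i ≡ toℕ v → reg τ j ≡ toℕ u → ⟦ edgeAt i j ⟧ τ ≡ e v u
    eval-edge {i} {j} v u i≡ j≡ = trans
      (cong (arr τ 2) (cong₂ _+_
          (trans (cong (arr τ 4) (trans i≡ (sym toℕ-v′))) (trans (base-arr v′) (cong (n *_) toℕ-v′))) j≡))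
      (e-arr v u)
      where
      v<L : toℕ v < L
      v<L = ≤-trans (toℕ<n v) (m≤m+n n M)
      v′ = fromℕ< v<L
      toℕ-v′ : toℕ v′ ≡ toℕ v
      toℕ-v′ = toℕ-fromℕ< v<L

    eval-c : ∀ {i} v → reg τ i ≡ toℕ v → ⟦ 1 [ var i ] ⟧ τ ≡ c v
    eval-c v i≡ rewrite i≡ = c-arr v

    eval-w : ∀ {i} v → reg τ i ≡ toℕ v → ⟦ 0 [ var i ] ⟧ τ ≡ w v
    eval-w v i≡ rewrite i≡ = w-arr v

    eval-excess : ∀ f {k} → ⟦ f ⟧ τ ≡ k → ⟦ excessOf f ⟧ τ ≡ excess k
    eval-excess f f≡ rewrite f≡ | sign-reg | abs-reg = refl

  eval-member : ∀ {τ} → Tables τ → ∀ {i j} y v → reg τ i ≡ toℕ y → reg τ j ≡ toℕ v → ⟦ memberAt i j ⟧ τ ≡ row y v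
  eval-member {τ} s {i} {j} y v i≡ j≡ = 
    trans (cong (arr τ 3) (eval-cell (Tables.layout s) {i} {j} y v i≡ j≡)) (Tables.row-arr s y v)

  add-guard : ∀ x f g {σ k m} → ⟦ f ⟧ σ ≡ k → ⟦ g ⟧ σ ≡ m →
    reg (run (when f (x := var x ⊕ g)) σ) x ≡ reg σ x + guard k m
  add-guard x f g {σ} refl refl with ⟦ f ⟧ σ
  ... | zero  = sym (+-identityʳ _)
  ... | suc _ = update-≡ (reg σ) x

  module _ (x : Fin L) where

    heavyTerm leakTerm : Row
    heavyTerm v = guard (closure (row x) v) (w v)
    leakTerm v = guard (row x v) (outside (row x) v)

    record Closing (i : ℕ) (τ : Store) : Set where
      field
        closure-arr   : ∀ v → toℕ v < i → arr τ 5 (toℕ v) ≡ closure (row x) v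
        heaviness-reg : reg τ 13 ≡ prefix heavyTerm i
        leak-reg      : reg τ 14 ≡ prefix leakTerm i

    close-step : ∀ {τ} v → Tables τ → reg τ 6 ≡ toℕ x → reg τ 9 ≡ toℕ v → Closing (toℕ v) τ →
      Closing (suc (toℕ v)) (tick 9 (run closeBody τ))
    close-step {τ} v s x≡ v≡ h = record
      { closure-arr = below-suc (λ u → arr τ₅ 5 (toℕ u) ≡ closure (row x) u) v
          (λ u u<v → trans (cong-app
              (trans (arrs (run-agree addLeak τ₄) 5 _) (arrs (run-agree addWeight τ₃) 5 _)) (toℕ u))
            (trans (update-≢ (arr τ₂ 5) (λ eq → <⇒≢ u<v (trans eq v₂)))
              (trans (cong-app (arrs a₂ 5 _) (toℕ u)) (closure-arr u u<v))))
          (trans (cong-app (trans (arrs (run-agree addLeak τ₄) 5 _) (arrs (run-agree addWeight τ₃) 5 _))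
              (toℕ v)) new₃)
      ; heaviness-reg = trans (regs (run-agree addLeak τ₄) 13 _)
          (trans (add-guard 13 (5 [ var 9 ]) (0 [ var 9 ]) {τ₃}
            (trans (cong (arr τ₃ 5) v₂) new₃) (eval-w (Tables.layout s₃) {9} v v₂))
          (trans (cong (_+ heavyTerm v) (trans (regs a₂ 13 _) heaviness-reg))
            (sym (prefix-suc heavyTerm v))))
      ; leak-reg = trans (add-guard 14 (memberAt 6 9) (var 12) {τ₄} (eval-member s₄ {6} {9} x v x₄ v₄)
            (trans (regs (run-agree addWeight τ₃) 12 _) out₂))
          (trans (cong (_+ leakTerm v) (trans (regs a₄ 14 _) leak-reg))
            (sym (prefix-suc leakTerm v)))
      }
      where
      open Closing h
      τ₁ = run insideSum τ
      τ₂ = run outsideSum τ₁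
      τ₃ = run closeVertex τ₂
      τ₄ = run addWeight τ₃
      τ₅ = run addLeak τ₄
      a₁ = run-agree insideSum τ
      a₂ = run-agree (insideSum ▸ outsideSum) τ
      a₃ = run-agree (insideSum ▸ outsideSum ▸ closeVertex) τ
      a₄ = run-agree (insideSum ▸ outsideSum ▸ closeVertex ▸ addWeight) τ
      s₁ = keep-tables a₁ _ s
      s₂ = keep-tables a₂ _ s
      s₃ = keep-tables a₃ _ s
      s₄ = keep-tables a₄ _ s
      v₂ : reg τ₂ 9 ≡ toℕ v
      v₂ = trans (regs a₂ 9 _) v≡
      v₄ : reg τ₄ 9 ≡ toℕ v
      v₄ = trans (regs a₄ 9 _) v≡
      x₄ : reg τ₄ 6 ≡ toℕ x
      x₄ = trans (regs a₄ 6 _) x≡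
      in₁ : reg τ₁ 11 ≡ inside (row x) v
      in₁ = sumInto-spec 11 10 insideTerm _ (Tables.n-reg s) _ _ _ λ u ρ u≡ a →
        let t = keep-tables a _ s in
        cong (_∸ 1) (cong₂ _+_
          (eval-edge (Tables.layout t) {9} {10} v u (trans (regs a 9 _) v≡) u≡)
          (eval-member t {6} {10} x u (trans (regs a 6 _) x≡) u≡))
      in₂ : reg τ₂ 11 ≡ inside (row x) v
      in₂ = trans (regs (run-agree outsideSum τ₁) 11 _) in₁
      out₂ : reg τ₂ 12 ≡ outside (row x) v
      out₂ = sumInto-spec 12 10 outsideTerm _ (Tables.n-reg s₁) _ _ _ λ u ρ u≡ a →
        let t = keep-tables a _ s₁ in
        cong (_∸ 1) (cong₂ _+_
          (eval-edge (Tables.layout t) {9} {10} v u (trans (regs a 9 _) (trans (regs a₁ 9 _) v≡)) u≡)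
          (cong₂ _∸_ (eval-c (Tables.layout t) {10} u u≡)
            (eval-member t {6} {10} x u (trans (regs a 6 _) (trans (regs a₁ 6 _) x≡)) u≡)))
      new₃ : arr τ₃ 5 (toℕ v) ≡ closure (row x) v
      new₃ = trans (cong (arr τ₃ 5) (sym v₂))
        (trans (update-≡ (arr τ₂ 5) (reg τ₂ 9))
        (cong₂ _+_ (eval-member s₂ {6} {9} x v (trans (regs a₂ 6 _) x≡) v₂)
          (cong₂ _∸_ (cong₂ (λ a b → (1 ∸ (1 ∸ a)) ∸ b) in₂ out₂) (eval-c (Tables.layout s₂) {9} v v₂))))

    record Closed (τ : Store) : Set where
      field
        closure-arr   : ∀ v → arr τ 5 (toℕ v) ≡ closure (row x) v
        heaviness-reg : reg τ 13 ≡ heaviness (row x)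
        defect-reg    : reg τ 14 ≡ leak (row x) + excess (heaviness (row x))

    close-spec : ∀ {σ} → Tables σ → reg σ 6 ≡ toℕ x → Closed (run close σ)
    close-spec {σ} s x≡ = record
      { closure-arr = λ v → Closing.closure-arr loop v (toℕ<n v)
      ; heaviness-reg = heavy
      ; defect-reg = cong₂ _+_ (trans (Closing.leak-reg loop) (prefix-all leakTerm))
          (eval-excess (Tables.layout s₁) (var 13) heavy) }
      where
      init = 13 := lit 0 ▸ 14 := lit 0
      loop : Closing n (run (for 9 0 closeBody) (run init σ))
      loop = for-rule 9 0 closeBody Closing (Tables.n-reg s) _
        (record { closure-arr = λ v → toℕ-≮0 v ; heaviness-reg = sym (prefix-zero heavyTerm)
                ; leak-reg = sym (prefix-zero leakTerm) })
        λ v τ v≡ a h → let a′ = agree-after init {σ = σ} a in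
          close-step v (keep-tables a′ _ s) (trans (regs a′ 6 _) x≡) v≡ h
      heavy : reg (run (for 9 0 closeBody) (run init σ)) 13 ≡ heaviness (row x)
      heavy = trans (Closing.heaviness-reg loop) (prefix-all heavyTerm)
      s₁ = keep-tables (run-agree (init ▸ for 9 0 closeBody) σ) _ s

  -- The dynamic program as a sequence of relaxations

  best : Store → Fin L → ℕ
  best τ y = arr τ 7 (toℕ y)

  keptRow : Store → Fin L → Row
  keptRow τ y v = arr τ 8 (at y v)

  -- `value isolated` stands on the left so that nothing is subtracted. The number `r` of blocks is
  -- left open: soundness holds whatever round an entry stems from.
  Sound : Store → Set
  Sound τ = ∀ y → 0 < best τ y →
    ∃[ r ] Partition r (row y) (keptRow τ y) × best τ y + value isolated ≡ suc (value (keptRow τ y))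

  -- The last field is stated for bounds g and h in place of best σ and best τ, so that
  -- later steps cannot invalidate it.
  record Progress (P : (Fin L → ℕ) → (Fin L → ℕ) → Set) (σ τ : Store) : Set where
    field
      sound : Sound τ
      grows : ∀ y → best σ y ≤ best τ y
      done  : ∀ g h → (∀ y → g y ≤ best σ y) → (∀ y → best τ y ≤ h y) → P g h

  module _ {p σ τ} (a : Agree p σ τ) where

    best-agree : T (keepsArr 7 p) → ∀ y → best τ y ≡ best σ y
    best-agree k y = cong-app (arrs a 7 k) (toℕ y)

    sound-agree : T (keepsArr 7 p ∧ keepsArr 8 p) → Sound σ → Sound τ
    sound-agree k s with ∧-elim {keepsArr 7 p} k
    ... | k7 , k8 rewrite arrs a 7 k7 | arrs a 8 k8 = s

    progress-agree : T (keepsArr 7 p) → ∀ {P ρ} → Progress P τ ρ → Progress P σ ρ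
    progress-agree k7 {P} {ρ} pr = record
      { sound = sound
      ; grows = λ y → subst (_≤ best ρ y) (best-agree k7 y) (grows y)
      ; done = λ g h g≤ h≥ → done g h (λ y → subst (g y ≤_) (sym (best-agree k7 y)) (g≤ y)) h≥ }
      where open Progress pr

  stay : ∀ {P σ τ p} → Agree p σ τ → T (keepsArr 7 p ∧ keepsArr 8 p) → Sound σ →
    (∀ g h → (∀ y → g y ≤ best σ y) → (∀ y → best σ y ≤ h y) → P g h) → Progress P σ τ
  stay {P} {σ} {τ} {p} a k s d with ∧-elim {keepsArr 7 p} k
  ... | k7 , k8 = record
    { sound = sound-agree a k s
    ; grows = λ y → ≤-reflexive (sym (best-agree a k7 y))
    ; done = λ g h g≤ h≥ → d g h g≤ (λ y → subst (_≤ h y) (best-agree a k7 y) (h≥ y)) }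

  -- Entries only grow, so a bound `g` below the table at the start of the loop is below it at every
  -- pass, and a bound `h` above the final table is above all earlier ones.
  for-progress : ∀ x r p {σ N} (P : Fin N → (Fin L → ℕ) → (Fin L → ℕ) → Set) →
    reg σ r ≡ N → T (keepsReg x p) → Sound σ →
    (∀ i τ → reg τ x ≡ toℕ i → Agree (for x r p) σ τ → Sound τ → Progress (P i) τ (run p τ)) →
    Progress (λ g h → ∀ i → P i g h) σ (run (for x r p) σ)
  for-progress x r p {σ} {N} P r≡ k s step = record
    { sound = Progress.sound end
    ; grows = Progress.grows end
    ; done = λ g h g≤ h≥ i → Progress.done end g h g≤ h≥ i (toℕ<n i) }
    where
    Inv : ℕ → Store → Set
    Inv j τ = Progress (λ g h → ∀ i → toℕ i < j → P i g h) σ τ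
    advance : ∀ i τ → reg τ x ≡ toℕ i → Agree (for x r p) σ τ → Inv (toℕ i) τ →
      Inv (suc (toℕ i)) (tick x (run p τ))
    advance i τ x≡ a inv = record
      { sound = B.sound
      ; grows = λ y → ≤-trans (A.grows y) (B.grows y)
      ; done = λ g h g≤ h≥ → below-suc (λ j → P j g h) i
          (A.done g h g≤ (λ y → ≤-trans (B.grows y) (h≥ y)))
          (B.done g h (λ y → ≤-trans (g≤ y) (A.grows y)) h≥) }
      where
      module A = Progress inv
      module B = Progress (step i τ x≡ a (Progress.sound inv))
    end : Inv N (run (for x r p) σ)
    end = for-rule x r p Inv r≡ k
      (record { sound = s ; grows = λ _ → ≤-refl ; done = λ _ _ _ _ i → toℕ-≮0 i }) advance

  keepsClosed : Prog → Bool
  keepsClosed p = keepsArr 5 p ∧ keepsReg 13 p ∧ keepsReg 14 p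

  keep-closed : ∀ {p σ τ x} → Agree p σ τ → T (keepsClosed p) → Closed x σ → Closed x τ
  keep-closed {p} a k cl with ∧-elim {keepsArr 5 p} k
  ... | k5 , k′ with ∧-elim {keepsReg 13 p} k′
  ... | k13 , k14 = record
    { closure-arr = λ v → trans (cong-app (arrs a 5 k5) _) (closure-arr v)
    ; heaviness-reg = trans (regs a 13 k13) heaviness-reg
    ; defect-reg = trans (regs a 14 k14) defect-reg }
    where open Closed cl

  module _ (x y z : Fin L) where

    Merges : Set
    Merges = ∀ v → row y v ≡ row x v + row z v

    -- The relaxation inequality of Bellman and Ford, for maxima: `x` is an arc from `z` to `y` of
    -- length `heaviness (row x)`, and entry 0 means that `z` has not been reached.
    Relaxed : (Fin L → ℕ) → (Fin L → ℕ) → Set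
    Relaxed g h = Merges → 0 < g z → heaviness (row x) + g z ≤ h y

    record Context (τ : Store) : Set where
      field
        tables : Tables τ
        closed : Closed x τ
        x-reg  : reg τ 6 ≡ toℕ x
        y-reg  : reg τ 7 ≡ toℕ y
        z-reg  : reg τ 8 ≡ toℕ z
      open Tables tables public
      open Closed closed public

    record Merged (σ : Store) (i : ℕ) (τ : Store) : Set where
      field
        changed   : ∀ v → toℕ v < i → keptRow τ y v ≡ closure (row x) v + keptRow σ z v
        unchanged : ∀ j → (∀ (v : Fin n) → toℕ v < i → j ≢ at y v) → arr τ 8 j ≡ arr σ 8 j

    merge-spec : ∀ {σ} → Context σ → Merged σ n (run merge σ)
    merge-spec {σ} ctx = for-rule 9 0 mergeBody (Merged σ) n-reg _
      (record { changed = λ v → toℕ-≮0 v ; unchanged = λ _ _ → refl })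
      step
      where
      open Context ctx
      step : ∀ v τ → reg τ 9 ≡ toℕ v → Agree merge σ τ → Merged σ (toℕ v) τ →
        Merged σ (suc (toℕ v)) (tick 9 (run mergeBody τ))
      step v τ v≡ a inv = record
        { changed = below-suc (λ u → arr τ′ 8 (at y u) ≡ closure (row x) u + keptRow σ z u) v
            (λ u u<v → trans (update-≢ (arr τ 8)
                (λ eq → <⇒≢ u<v (cong toℕ (proj₂ (at-injective y y u v (trans eq address))))))
              (changed u u<v))
            (trans (cong (arr τ′ 8) (sym address)) (trans (update-≡ (arr τ 8) _) new))
        ; unchanged = λ j j≢ → trans (update-≢ (arr τ 8) (λ eq → j≢ v ≤-refl (trans eq address)))
            (unchanged j (λ u u<v → j≢ u (m≤n⇒m≤1+n u<v))) }
        where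
        open Merged inv
        τ′ = run mergeBody τ
        lay : Layout τ
        lay = keep-layout a _ layout
        y≡ : reg τ 7 ≡ toℕ y
        y≡ = trans (regs a 7 _) y-reg
        z≡ : reg τ 8 ≡ toℕ z
        z≡ = trans (regs a 8 _) z-reg
        address : ⟦ 4 [ var 7 ] ⊕ var 9 ⟧ τ ≡ at y v
        address = eval-cell lay {7} {9} y v y≡ v≡
        new : ⟦ 5 [ var 9 ] ⊕ keptAt 8 9 ⟧ τ ≡ closure (row x) v + keptRow σ z v
        new = cong₂ _+_
          (trans (cong (arr τ 5) v≡) (trans (cong-app (arrs a 5 _) (toℕ v)) (closure-arr v)))
          (trans (cong (arr τ 8) (eval-cell lay {8} {9} z v z≡ v≡))
            -- Even if `z` and `y` coincide, this cell is still untouched: the earlier passes wrote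
            -- only at vertices before `v`.
            (unchanged (at z v) λ u u<v eq → <⇒≢ u<v (cong toℕ (sym (proj₂ (at-injective z y v u eq))))))

    gap : Row
    gap v = (row y v ∸ (row x v + row z v)) + ((row x v + row z v) ∸ row y v)

    mismatch-spec : ∀ {σ} → Context σ → reg (run (sumInto 11 9 mismatchTerm) σ) 11 ≡ sum gap
    mismatch-spec {σ} ctx = sumInto-spec 11 9 mismatchTerm gap n-reg _ _ _ λ v τ v≡ a →
      let t = keep-tables a _ tables
          X = eval-member t {6} {9} x v (trans (regs a 6 _) x-reg) v≡
          Y = eval-member t {7} {9} y v (trans (regs a 7 _) y-reg) v≡
          Z = eval-member t {8} {9} z v (trans (regs a 8 _) z-reg) v≡
      in cong₂ _+_ (cong₂ _∸_ Y (cong₂ _+_ X Z)) (cong₂ _∸_ (cong₂ _+_ X Z) Y)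
      where open Context ctx

    merges⇒gap : Merges → sum gap ≡ 0
    merges⇒gap m = sum-zero λ v → cong₂ _+_ (m≤n⇒m∸n≡0 (≤-reflexive (m v)))
        (m≤n⇒m∸n≡0 (≤-reflexive (sym (m v))))

    gap⇒merges : sum gap ≡ 0 → Merges
    gap⇒merges eq v = ≤-antisym
      (m∸n≡0⇒m≤n (m+n≡0⇒m≡0 _ (sum-zero⁻¹ gap eq v)))
      (m∸n≡0⇒m≤n (m+n≡0⇒n≡0 (row y v ∸ (row x v + row z v)) (sum-zero⁻¹ gap eq v)))

    keep-context : ∀ {p σ τ} → Agree p σ τ → T (keepsTables p) → T (keepsClosed p) →
      T (keepsReg 6 p ∧ keepsReg 7 p ∧ keepsReg 8 p) → Context σ → Context τ
    keep-context {p} a k kc k′ ctx with ∧-elim {keepsReg 6 p} k′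
    ... | k6 , k″ with ∧-elim {keepsReg 7 p} k″
    ... | k7 , k8 = record
      { tables = keep-tables a k tables
      ; closed = keep-closed a kc closed
      ; x-reg = trans (regs a 6 k6) x-reg
      ; y-reg = trans (regs a 7 k7) y-reg
      ; z-reg = trans (regs a 8 k8) z-reg }
      where open Context ctx

    update-spec : ∀ {σ} → Context σ → Sound σ → Block (row x) → Merges → 0 < best σ z →
      best σ y ≤ heaviness (row x) + best σ z →
      Progress Relaxed σ (run (setBest ▸ merge) σ)
    update-spec {σ} ctx s block merges pos le = record
      { sound = sound′
      ; grows = grows′
      ; done = λ g h g≤ h≥ _ _ → ≤-trans (+-monoʳ-≤ _ (g≤ z)) (subst (_≤ h y) best-y (h≥ y)) }
      where
      open Context ctx
      σ₁ = run setBest σ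
      τ = run merge σ₁
      ctx₁ : Context σ₁
      ctx₁ = record { tables = keep-tables (run-agree setBest σ) _ tables
                    ; closed = record { closure-arr = closure-arr ; heaviness-reg = heaviness-reg ; defect-reg = defect-reg }
                    ; x-reg = x-reg ; y-reg = y-reg ; z-reg = z-reg }
      open Merged (merge-spec ctx₁)
      best-y : best τ y ≡ heaviness (row x) + best σ z
      best-y = trans (cong-app (arrs (run-agree merge σ₁) 7 _) (toℕ y))
        (trans (cong (arr σ₁ 7) (sym y-reg))
            (trans (update-≡ (arr σ 7) (reg σ 7)) (cong₂ _+_ heaviness-reg (cong (arr σ 7) z-reg))))
      best-other : ∀ y′ → y′ ≢ y → best τ y′ ≡ best σ y′
      best-other y′ y′≢y = trans (cong-app (arrs (run-agree merge σ₁) 7 _) (toℕ y′))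
        (update-≢ (arr σ 7) (λ eq → y′≢y (toℕ-injective (trans eq y-reg))))
      kept-other : ∀ y′ → y′ ≢ y → ∀ v → keptRow τ y′ v ≡ keptRow σ y′ v
      kept-other y′ y′≢y v = unchanged (at y′ v) λ u _ eq → y′≢y (proj₁ (at-injective y′ y v u eq))
      grows′ : ∀ y′ → best σ y′ ≤ best τ y′
      grows′ y′ with y′ Fin.≟ y
      ... | yes refl = subst (best σ y ≤_) (sym best-y) le
      ... | no y′≢y = ≤-reflexive (sym (best-other y′ y′≢y))
      sound′ : Sound τ
      sound′ y′ pos′ with y′ Fin.≟ y
      sound′ y′ pos′ | no y′≢y with s y′ (subst (0 <_) (best-other y′ y′≢y) pos′)
      ... | r , p , eq = r , partition-resp (λ _ → refl) (kept-other y′ y′≢y) p ,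
        trans (cong (_+ value isolated) (best-other y′ y′≢y))
            (trans eq (cong suc (sum-cong-≗ λ v → cong (_* w v) (sym (kept-other y′ y′≢y v)))))
      -- The partition of row `z` is taken from the store before the update, which also covers
      -- `z = y`.
      sound′ y′ pos′ | yes refl with s z pos
      ... | r , p , eq = suc r , add block p merges new , (begin
        best τ y + value isolated                                  ≡⟨ cong (_+ value isolated) best-y ⟩
        heaviness (row x) + best σ z + value isolated              ≡⟨ +-assoc (heaviness (row x)) _ _ ⟩
        heaviness (row x) + (best σ z + value isolated)            ≡⟨ cong (heaviness (row x) +_) eq ⟩
        heaviness (row x) + suc (value (keptRow σ z))              ≡⟨ +-suc (heaviness (row x)) _ ⟩
        suc (heaviness (row x) + value (keptRow σ z))              ≡⟨ cong
            (λ k → suc (k + value (keptRow σ z))) (heaviness-value {row x} (Block.≤c block)) ⟩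
        suc (value (closure (row x)) + value (keptRow σ z))        ≡⟨ cong suc
            (value-+ {X = closure (row x)} {keptRow σ z} new) ⟨
        suc (value (keptRow τ y))                                  ∎)
        where
        open ≡-Reasoning
        new : ∀ v → keptRow τ y v ≡ closure (row x) v + keptRow σ z v
        new v = changed v (toℕ<n v)

    -- Each failing test leaves nothing to do: either a premise of `Relaxed` is false, or the entry
    -- of `y` is already large enough.
    relax-spec : ∀ {σ} → Context σ → Sound σ → Block (row x) → Progress Relaxed σ (run relax σ)
    relax-spec {σ} ctx s block =
      when-rule (7 [ var 8 ]) (when ((var 13 ⊕ 7 [ var 8 ]) ⊖ 7 [ var 7 ]) improve) {σ} (Progress Relaxed σ)
        (λ eq → when-rule ((var 13 ⊕ 7 [ var 8 ]) ⊖ 7 [ var 7 ]) improve {σ} (Progress Relaxed σ)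
          (λ eq′ → try (subst (0 <_) (trans (sym eq) best-z) z<s)
            (∸-suc⇒≤ (trans (sym gain) eq′)))
          -- This program computes to the identity and so supplies an `Agree` from `σ` to itself.
          (λ eq′ → stay (run-agree (when (lit 0) (0 := lit 0)) σ) _ s λ g h g≤ h≥ _ _ →
            ≤-trans (+-monoʳ-≤ _ (g≤ z)) (≤-trans (m∸n≡0⇒m≤n (trans (sym gain) eq′)) (h≥ y))))
        (λ eq → stay (run-agree (when (lit 0) (0 := lit 0)) σ) _ s λ g h g≤ _ _ pos →
          contradiction (trans (sym best-z) eq) (>⇒≢ (≤-trans pos (g≤ z))))
      where
      open Context ctx
      ∸-suc⇒≤ : ∀ {a b k} → a ∸ b ≡ suc k → b ≤ a
      ∸-suc⇒≤ eq = <⇒≤ (m∸n≢0⇒n<m λ eq₀ → 0≢1+n (trans (sym eq₀) eq))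
      q = sumInto 11 9 mismatchTerm
      best-z : ⟦ 7 [ var 8 ] ⟧ σ ≡ best σ z
      best-z = cong (arr σ 7) z-reg
      gain : ⟦ (var 13 ⊕ 7 [ var 8 ]) ⊖ 7 [ var 7 ] ⟧ σ ≡ (heaviness (row x) + best σ z) ∸ best σ y
      gain = cong₂ _∸_ (cong₂ _+_ heaviness-reg best-z) (cong (arr σ 7) y-reg)
      σ₁ = run q σ
      a₁ = run-agree q σ
      try : 0 < best σ z → best σ y ≤ heaviness (row x) + best σ z → Progress Relaxed σ (run improve σ)
      try pos le = when-rule (lit 1 ⊖ var 11) (setBest ▸ merge) {σ₁} (Progress Relaxed σ)
        (λ eq → progress-agree a₁ _ (update-spec (keep-context {q} a₁ _ _ _ ctx) (sound-agree a₁ _ s) block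
          (gap⇒merges (trans (sym (mismatch-spec ctx)) (1∸-suc eq)))
          (subst (0 <_) (sym (best-agree a₁ _ z)) pos)
          (subst₂ (λ a b → a ≤ heaviness (row x) + b) (sym (best-agree a₁ _ y))
              (sym (best-agree a₁ _ z)) le)))
        (λ eq → stay a₁ _ s λ g h _ _ merges _ →
          contradiction (trans (cong (1 ∸_) (sym (trans (mismatch-spec ctx) (merges⇒gap merges)))) eq) λ ())
        where
        1∸-suc : ∀ {a k} → 1 ∸ a ≡ suc k → a ≡ 0
        1∸-suc {zero} _ = refl
        1∸-suc {suc a} eq = contradiction (trans (sym (0∸n≡0 a)) eq) λ ()

  progress-map : ∀ {P Q σ τ} → (∀ g h → P g h → Q g h) → Progress P σ τ → Progress Q σ τ
  progress-map f pr = record { sound = sound ; grows = grows ; done = λ g h g≤ h≥ → f g h (done g h g≤ h≥) }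
    where open Progress pr

  RelaxedAt : Fin L → (Fin L → ℕ) → (Fin L → ℕ) → Set
  RelaxedAt x g h = Block (row x) → ∀ y z → Relaxed x y z g h

  round-spec : ∀ {σ} → Tables σ → Sound σ → Progress (λ g h → ∀ x → RelaxedAt x g h) σ (run round σ)
  round-spec {σ} tables s = for-progress 6 3 body RelaxedAt (Tables.L-reg tables) _ s λ x τ x≡ a sτ →
    let t  = keep-tables a _ tables
        cl = close-spec x t x≡
        a₁ = run-agree close τ
        t₁ = keep-tables a₁ _ t
        x₁ = trans (regs a₁ 6 _) x≡
    in when-rule (lit 1 ⊖ var 14) pairs {run close τ} (Progress (RelaxedAt x) τ)
      (λ eq → progress-agree a₁ _ (progress-map (λ _ _ r _ → r)
        (for-progress 7 3 inner (λ y g h → ∀ z → Relaxed x y z g h) (Tables.L-reg t₁) _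
            (sound-agree a₁ _ sτ) λ y τ₂ y≡ a₂ s₂ →
          for-progress 8 3 relax (λ z → Relaxed x y z)
              (Tables.L-reg (keep-tables a₂ _ t₁)) _ s₂ λ z τ₃ z≡ a₃ s₃ →
            relax-spec x y z
              (record { tables = keep-tables a₃ _ (keep-tables a₂ _ t₁)
                      ; closed = keep-closed a₃ _ (keep-closed a₂ _ cl)
                      ; x-reg = trans (regs a₃ 6 _) (trans (regs a₂ 6 _) x₁)
                      ; y-reg = trans (regs a₃ 7 _) y≡
                      ; z-reg = z≡ })
              s₃ (no-defect⇒block x (no-defect (trans (cong (1 ∸_) (sym (Closed.defect-reg cl))) eq))))))
      (λ eq → stay a₁ _ sτ λ _ _ _ _ b → contradiction
        (trans (cong (1 ∸_) (sym (trans (Closed.defect-reg cl)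
            (cong₂ _+_ (Block.closed b) (Block.light b))))) eq) λ ())
    where
    inner = for 8 3 relax
    pairs = for 7 3 inner
    body = close ▸ when (lit 1 ⊖ var 14) pairs
    no-defect : ∀ {a k} → 1 ∸ a ≡ suc k → a ≡ 0
    no-defect {zero} _ = refl
    no-defect {suc a} eq = contradiction (trans (sym (0∸n≡0 a)) eq) λ ()
    no-defect⇒block : ∀ x → leak (row x) + excess (heaviness (row x)) ≡ 0 → Block (row x)
    no-defect⇒block x eq = record
      { ≤c = decode-≤ C (toℕ x)
      ; closed = m+n≡0⇒m≡0 _ eq
      ; light = m+n≡0⇒n≡0 (leak (row x)) eq }

  -- Completeness: every partition is matched after enough rounds

  module _ {Y : Row} (Y≤c : ∀ v → Y v ≤ c v) where

    encode<L : encode C Y < L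
    encode<L = ≤-trans (encode-< C Y Y≤c) (m≤n+m M n)

    index : Fin L
    index = fromℕ< encode<L

    toℕ-index : toℕ index ≡ encode C Y
    toℕ-index = toℕ-fromℕ< encode<L

    row-index : ∀ v → row index v ≡ Y v
    row-index v = trans (cong (λ k → decode C k v) toℕ-index) (decode-encode C Y Y≤c v)

  module _ {X X′ : Row} (X≗X′ : ∀ v → X v ≡ X′ v) where

    inside-cong : ∀ v → inside X v ≡ inside X′ v
    inside-cong v = sum-cong-≗ λ u → cong (λ k → (e v u + k) ∸ 1) (X≗X′ u)

    outside-cong : ∀ v → outside X v ≡ outside X′ v
    outside-cong v = sum-cong-≗ λ u → cong (λ k → (e v u + (c u ∸ k)) ∸ 1) (X≗X′ u)

    closure-cong : ∀ v → closure X v ≡ closure X′ v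
    closure-cong v = cong₂ _+_ (X≗X′ v)
      (cong (_∸ c v) (cong₂ (λ a b → (1 ∸ (1 ∸ a)) ∸ b) (inside-cong v) (outside-cong v)))

    heaviness-cong : heaviness X ≡ heaviness X′
    heaviness-cong = sum-cong-≗ λ v → cong (λ k → guard k (w v)) (closure-cong v)

    block-resp : Block X′ → Block X
    block-resp b = record
      { ≤c = λ v → subst (_≤ c v) (sym (X≗X′ v)) (≤c v)
      ; closed = trans (sum-cong-≗ λ v → cong₂ guard (X≗X′ v) (outside-cong v)) closed
      ; light = trans (cong excess heaviness-cong) light }
      where open Block b

  -- An inequality only: updates in place can use entries improved in the same round, so an entry
  -- may beat all partitions into at most `k` blocks.
  Complete : ℕ → Store → Set
  Complete k τ = ∀ {r Y K} (Y≤c : ∀ v → Y v ≤ c v) → r ≤ k → Partition r Y K →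
    0 < best τ (index Y≤c) × suc (value K) ≤ best τ (index Y≤c) + value isolated

  -- Peel off the block `X` added last: the rest is matched by the entry of `Z` before the round,
  -- and relaxing the codes of `X`, `Y` and `Z` adds the weight of the closure of `X`.
  complete-suc : ∀ {k σ τ} → Progress (λ g h → ∀ x → RelaxedAt x g h) σ τ → Complete k σ →
    Complete (suc k) τ
  complete-suc pr comp Y≤c _ p@(empty _ _ _) with comp Y≤c z≤n p
  ... | pos , le = ≤-trans pos (Progress.grows pr (index Y≤c)) ,
    ≤-trans le (+-monoˡ-≤ _ (Progress.grows pr (index Y≤c)))
  complete-suc {σ = σ} {τ} pr comp Y≤c (s≤s r≤k) (add {X = X} {Z = Z} {K = K} {J = J} b p y≡ k≡) =
    ≤-trans pos (≤-trans (m≤n+m _ (heaviness (row x))) relaxed) , (begin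
    suc (value K)                                          ≡⟨ cong suc (value-+ {X = closure X} {J} k≡) ⟩
    suc (value (closure X) + value J)                      ≡⟨ +-suc (value (closure X)) (value J) ⟨
    value (closure X) + suc (value J)                      ≡⟨ cong (_+ suc (value J))
        (trans (sym (heaviness-value {X} (Block.≤c b))) (sym (heaviness-cong x≗))) ⟩
    heaviness (row x) + suc (value J)                      ≤⟨ +-monoʳ-≤ (heaviness (row x))
        (proj₂ (comp Z≤c r≤k p)) ⟩
    heaviness (row x) + (best σ z + value isolated)        ≡⟨ +-assoc (heaviness (row x)) (best σ z)
        (value isolated) ⟨
    heaviness (row x) + best σ z + value isolated          ≤⟨ +-monoˡ-≤ (value isolated) relaxed ⟩
    best τ (index Y≤c) + value isolated                    ∎)
    where
    open ≤-Reasoning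
    Z≤c : ∀ v → Z v ≤ c v
    Z≤c v = ≤-trans (subst (Z v ≤_) (sym (y≡ v)) (m≤n+m (Z v) (X v))) (Y≤c v)
    x = index (Block.≤c b)
    z = index Z≤c
    x≗ = row-index (Block.≤c b)
    pos : 0 < best σ z
    pos = proj₁ (comp Z≤c r≤k p)
    relaxed : heaviness (row x) + best σ z ≤ best τ (index Y≤c)
    relaxed = Progress.done pr (best σ) (best τ) (λ _ → ≤-refl) (λ _ → ≤-refl) x (block-resp x≗ b)
        (index Y≤c) z
      (λ v → trans (row-index Y≤c v) (trans (y≡ v) (cong₂ _+_ (sym (x≗ v)) (sym (row-index Z≤c v)))))
      pos

  rounds-spec : ∀ {σ} → Tables σ → Sound σ → Complete 0 σ → Sound (run rounds σ) × Complete n (run rounds σ)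
  rounds-spec {σ} tables s comp = for-rule 5 0 round (λ k τ → Sound τ × Complete k τ)
      (Tables.n-reg tables) _
    (s , comp) λ k τ _ a (s′ , comp′) →
      let pr = round-spec (keep-tables a _ tables) s′
      in Progress.sound pr , complete-suc pr comp′

  -- Initial tables

  encode-zero : ∀ {n} (C : Subset n) {Y} → (∀ v → Y v ≡ 0) → encode C Y ≡ 0
  encode-zero []          z = refl
  encode-zero (true  ∷ C) z = cong₂ _+_ (z zero) (cong (λ t → t + t) (encode-zero C (z ∘ suc)))
  encode-zero (false ∷ C) z = encode-zero C (z ∘ suc)

  isolatedTerm : Row
  isolatedTerm v = guard (isolated v) (excess (w v))

  record Isolating (i : ℕ) (τ : Store) : Set where
    field
      isolated-arr : ∀ v → toℕ v < i → arr τ 8 (toℕ v) ≡ isolated v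
      excess-reg   : reg τ 14 ≡ prefix isolatedTerm i

  isolate-step : ∀ {τ} v → Layout τ → reg τ 9 ≡ toℕ v → Isolating (toℕ v) τ →
    Isolating (suc (toℕ v)) (tick 9 (run isolate τ))
  isolate-step {τ} v s v≡ h = record
    { isolated-arr = below-suc (λ u → arr τ₃ 8 (toℕ u) ≡ isolated u) v
        (λ u u<v → trans (cong-app (arrs (run-agree addExcess τ₂) 8 _) (toℕ u))
          (trans (update-≢ (arr τ₁ 8) (λ eq → <⇒≢ u<v (trans eq v₁)))
            (trans (cong-app (arrs a₁ 8 _) (toℕ u)) (isolated-arr u u<v))))
        (trans (cong-app (arrs (run-agree addExcess τ₂) 8 _) (toℕ v)) new)
    ; excess-reg = trans
        (add-guard 14 (8 [ var 9 ]) (excessOf (0 [ var 9 ])) {τ₂}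
          (trans (cong (arr τ₂ 8) v₁) new)
          (eval-excess (keep-layout a₂ _ s) (0 [ var 9 ]) (eval-w (keep-layout a₂ _ s) {9} v v₁)))
        (trans (cong (_+ isolatedTerm v) (trans (regs a₁ 14 _) excess-reg))
            (sym (prefix-suc isolatedTerm v))) }
    where
    open Isolating h
    τ₁ = run degree τ
    τ₂ = run markIsolated τ₁
    τ₃ = run addExcess τ₂
    a₁ = run-agree degree τ
    a₂ = run-agree (degree ▸ markIsolated) τ
    s₁ = keep-layout a₁ _ s
    v₁ : reg τ₁ 9 ≡ toℕ v
    v₁ = trans (regs a₁ 9 _) v≡
    new : arr τ₂ 8 (toℕ v) ≡ isolated v
    new = trans (cong (arr τ₂ 8) (sym v₁)) (trans (update-≡ (arr τ₁ 8) (reg τ₁ 9))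
      (cong₂ _∸_ (cong (1 ∸_) (eval-c s₁ {9} v v₁))
        (sumInto-spec 11 10 (edgeAt 9 10) (e v) (Layout.n-reg s) _ _ _ λ u ρ u≡ a →
          eval-edge (keep-layout a _ s) {9} {10} v u (trans (regs a 9 _) v≡) u≡)))

  start-spec : ∀ {σ} → Layout σ → (∀ i → arr σ 7 i ≡ 0) → Sound (run start σ) × Complete 0 (run start σ)
  start-spec {σ} s zeros = sound , complete
    where
    σ₁ = run (14 := lit 0 ▸ for 9 0 isolate) σ
    a₁ = run-agree (14 := lit 0 ▸ for 9 0 isolate) σ
    τ = run start σ
    loop : Isolating n σ₁
    loop = for-rule 9 0 isolate Isolating (Layout.n-reg s) _
      (record { isolated-arr = λ v → toℕ-≮0 v ; excess-reg = sym (prefix-zero isolatedTerm) })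
      λ v τ v≡ a h → isolate-step v (keep-layout (agree-after (14 := lit 0) {σ = σ} a) _ s) v≡ h
    total : reg σ₁ 14 ≡ isolatedExcess
    total = trans (Isolating.excess-reg loop) (prefix-all isolatedTerm)
    best-zero : ∀ y → toℕ y ≡ 0 → best τ y ≡ 1 ∸ isolatedExcess
    best-zero y y≡0 = trans (cong (arr τ 7) y≡0) (cong (1 ∸_) total)
    best-other : ∀ y → toℕ y ≢ 0 → best τ y ≡ 0
    best-other y y≢0 = trans (update-≢ (arr σ₁ 7) y≢0)
        (trans (cong-app (arrs a₁ 7 _) (toℕ y)) (zeros (toℕ y)))
    kept-zero : ∀ y → toℕ y ≡ 0 → ∀ v → keptRow τ y v ≡ isolated v
    kept-zero y y≡0 v = trans (cong (λ k → arr σ₁ 8 (k + toℕ v)) (trans (cong (n *_) y≡0) (*-zeroʳ n)))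
      (Isolating.isolated-arr loop v (toℕ<n v))
    sound : Sound τ
    sound y pos with toℕ y ≟ 0
    ... | no y≢0 = contradiction (best-other y y≢0) (>⇒≢ pos)
    ... | yes y≡0 = 0 , empty none (λ v → trans (cong (λ k → decode C k v) y≡0) (decode-zero C v))
        (kept-zero y y≡0) ,
      cong₂ _+_ (trans (best-zero y y≡0) (cong (1 ∸_) none))
          (sum-cong-≗ λ v → cong (_* w v) (sym (kept-zero y y≡0 v)))
      where
      1∸-positive : ∀ a → 0 < 1 ∸ a → a ≡ 0
      1∸-positive zero    _ = refl
      1∸-positive (suc a) p = contradiction (0∸n≡0 a) (>⇒≢ p)
      none : isolatedExcess ≡ 0
      none = 1∸-positive _ (subst (0 <_) (best-zero y y≡0) pos)
    complete : Complete 0 τ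
    complete Y≤c _ (empty none y≡ k≡) = ≤-reflexive (sym one) ,
      ≤-reflexive (cong₂ _+_ (sym one) (sum-cong-≗ λ v → cong (_* w v) (k≡ v)))
      where
      one : best τ (index Y≤c) ≡ 1
      one = trans (best-zero _ (trans (toℕ-index Y≤c) (encode-zero C y≡))) (cong (1 ∸_) none)

  multiples-spec : ∀ {σ} → Sizes σ → Layout (run multiples σ)
  multiples-spec {σ} s = record
    { sizes = keep-sizes (run-agree multiples σ) _ s
    ; base-arr = λ i → proj₁ loop i (toℕ<n i) }
    where
    body = 4 [ var 6 ]:= var 15 ▸ 15 := var 15 ⊕ var 0
    Inv : ℕ → Store → Set
    Inv k τ = (∀ (i : Fin L) → toℕ i < k → arr τ 4 (toℕ i) ≡ n * toℕ i) × reg τ 15 ≡ n * k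
    step : ∀ i τ → reg τ 6 ≡ toℕ i → Agree (for 6 3 body) (setReg 15 0 σ) τ → Inv (toℕ i) τ →
      Inv (suc (toℕ i)) (tick 6 (run body τ))
    step i τ i≡ a (old , s≡) =
      below-suc (λ j → arr (run body τ) 4 (toℕ j) ≡ n * toℕ j) i
        (λ j j<i → trans (update-≢ (arr τ 4) (λ eq → <⇒≢ j<i (trans eq i≡))) (old j j<i))
        (trans (cong (arr (run body τ) 4) (sym i≡)) (trans (update-≡ (arr τ 4) (reg τ 6)) s≡))
      , trans (cong₂ _+_ s≡ (trans (regs a 0 _) (Sizes.n-reg s)))
          (trans (+-comm _ n) (sym (*-suc n (toℕ i))))
    loop : Inv L (run multiples σ)
    loop = for-rule 6 3 body Inv (Sizes.L-reg s) _ ((λ i → toℕ-≮0 i) , sym (*-zeroʳ n)) step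

  halves-spec : ∀ {σ} → Layout σ → (∀ i → arr σ 6 i ≡ 0) → ∀ j → j < L → arr (run halves σ) 6 j ≡ ⌊ j /2⌋
  halves-spec {σ} s zeros j j<L = loop j (≤-trans j<L (m≤n+m L 2))
    where
    body = 6 [ var 6 ⊕ lit 2 ]:= 6 [ var 6 ] ⊕ lit 1
    -- Pass `i` fills cell `i + 2`, so the invariant is two cells ahead of the counter. The first
    -- two halves are 0, as the array is initially.
    Inv : ℕ → Store → Set
    Inv k τ = ∀ j → j < 2 + k → arr τ 6 j ≡ ⌊ j /2⌋
    step : ∀ i τ → reg τ 6 ≡ toℕ i → Agree halves σ τ → Inv (toℕ i) τ → Inv (suc (toℕ i))
        (tick 6 (run body τ))
    step i τ i≡ a old j j< with j ≟ reg τ 6 + 2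
    ... | yes refl = trans (update-≡ (arr τ 6) _) (trans (+-comm _ 1)
          (trans (cong suc (old (reg τ 6) (subst (_< 2 + toℕ i) (sym i≡) (n<1+m⇒ (toℕ i)))))
            (cong ⌊_/2⌋ (+-comm 2 (reg τ 6)))))
      where
      n<1+m⇒ : ∀ k → k < 2 + k
      n<1+m⇒ k = m≤n⇒m≤1+n ≤-refl
    ... | no j≢ = trans (update-≢ (arr τ 6) j≢)
          (old j (≤∧≢⇒< (≤-pred j<) λ eq → j≢ (trans eq (trans (+-comm 2 (toℕ i)) (cong (_+ 2) (sym i≡))))))
    init : ∀ j → j < 2 → arr σ 6 j ≡ ⌊ j /2⌋
    init 0 _ = zeros 0
    init 1 _ = zeros 1
    init (suc (suc _)) (s≤s (s≤s ()))
    loop : Inv L (run halves σ)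
    loop = for-rule 6 3 body Inv (Layout.L-reg s) _ init step

  bit-zero : ∀ {b} → bit b ≡ 0 → b ≡ false
  bit-zero {false} _ = refl

  bit-suc : ∀ {b k} → bit b ≡ suc k → b ≡ true
  bit-suc {true} _ = refl

  Halves : Store → Set
  Halves τ = ∀ j → j < L → arr τ 6 j ≡ ⌊ j /2⌋

  module _ (y : Fin L) where

    record Digits (σ : Store) (i : ℕ) (τ : Store) : Set where
      field
        rest    : reg τ 15 ≡ remaining C (toℕ y) i
        written : ∀ v → toℕ v < i → arr τ 3 (at y v) ≡ row y v
        other   : ∀ y′ (v : Fin n) → y′ ≢ y → arr τ 3 (at y′ v) ≡ arr σ 3 (at y′ v)

    digits-spec : ∀ {σ} → Layout σ → Halves σ → reg σ 6 ≡ toℕ y → reg σ 15 ≡ toℕ y →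
      Digits σ n (run digits σ)
    digits-spec {σ} s half y≡ r≡ = for-rule 9 0 (writeDigit ▸ dropDigit) (Digits σ) (Layout.n-reg s) _
      (record { rest = trans r≡ (sym (remaining-zero C (toℕ y)))
              ; written = λ v → toℕ-≮0 v
              ; other = λ _ _ _ → refl })
      step
      where
      step : ∀ v τ → reg τ 9 ≡ toℕ v → Agree digits σ τ → Digits σ (toℕ v) τ →
        Digits σ (suc (toℕ v)) (tick 9 (run (writeDigit ▸ dropDigit) τ))
      step v τ v≡ a h = record
        { rest = trans (when-rule (1 [ var 9 ]) (15 := 6 [ var 15 ]) {τ₁}
            (λ ρ → reg ρ 15 ≡ shift (lookup C v) r)
            (λ eq → trans half-r (cong (λ b → shift b r) (sym (bit-suc (trans (sym c≡) eq)))))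
            (λ eq → trans rest (cong (λ b → shift b r) (sym (bit-zero (trans (sym c≡) eq))))))
            (sym (remaining-suc C (toℕ y) v))
        ; written = below-suc (λ u → arr τ₂ 3 (at y u) ≡ row y u) v
            (λ u u<v → trans (cong-app (arrs (run-agree dropDigit τ₁) 3 _) (at y u))
              (trans (update-≢ (arr τ 3)
                  (λ eq → <⇒≢ u<v (cong toℕ (proj₂ (at-injective y y u v (trans eq address))))))
                (written u u<v)))
            (trans (cong-app (arrs (run-agree dropDigit τ₁) 3 _) (at y v))
              (trans (cong (arr τ₁ 3) (sym address)) (trans (update-≡ (arr τ 3) _)
                (cong (_∸ 1) (cong₂ _+_ c≡ (cong₂ _∸_ rest (cong₂ _+_ half-r half-r)))))))
        ; other = λ y′ u y′≢y → trans (cong-app (arrs (run-agree dropDigit τ₁) 3 _) (at y′ u))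
            (trans (update-≢ (arr τ 3) (λ eq → y′≢y (proj₁ (at-injective y′ y u v (trans eq address)))))
                (other y′ u y′≢y))
        }
        where
        open Digits h
        τ₁ = run writeDigit τ
        τ₂ = run dropDigit τ₁
        r = remaining C (toℕ y) (toℕ v)
        t : Layout τ
        t = keep-layout a _ s
        c≡ : arr τ 1 (reg τ 9) ≡ c v
        c≡ = eval-c t {9} v v≡
        address : ⟦ 4 [ var 6 ] ⊕ var 9 ⟧ τ ≡ at y v
        address = eval-cell t {6} {9} y v (trans (regs a 6 _) y≡) v≡
        half-r : arr τ 6 (reg τ 15) ≡ ⌊ r /2⌋
        half-r = trans (cong-app (arrs a 6 _) _) (trans (cong (arr σ 6) rest)
          (half r (≤-<-trans (remaining-≤ C (toℕ y) (toℕ v)) (toℕ<n y))))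

  rows-spec : ∀ {σ} → Layout σ → Halves σ → Tables (run rows σ)
  rows-spec {σ} s half = record
    { layout = keep-layout (run-agree rows σ) _ s
    ; row-arr = λ y → loop y (toℕ<n y) }
    where
    body = 15 := var 6 ▸ digits
    Inv : ℕ → Store → Set
    Inv k τ = ∀ y → toℕ y < k → ∀ v → arr τ 3 (at y v) ≡ row y v
    loop : Inv L (run rows σ)
    loop = for-rule 6 3 body Inv (Layout.L-reg s) _ (λ y → toℕ-≮0 y) λ y τ y≡ a old →
      let τ₁ = run (15 := var 6) τ
          t = keep-layout (run-agree (15 := var 6) τ) _ (keep-layout a _ s)
          d = digits-spec y {τ₁} t (λ j j<L → trans (cong-app (arrs a 6 _) j) (half j j<L)) y≡ y≡
      in below-suc (λ z → ∀ v → arr (run body τ) 3 (at z v) ≡ row z v) y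
           (λ z z<y v → trans (Digits.other d z v (λ z≡y → <⇒≢ z<y (cong toℕ z≡y))) (old z z<y v))
           (λ v → Digits.written d v (toℕ<n v))

  count-spec : ∀ {σ} → Inputs σ → reg (run countSubsets σ) 4 ≡ M
  count-spec {σ} s = trans (for-rule 9 0 body (λ k τ → reg τ 4 ≡ 2 ^ prefix c k) (Inputs.n-reg s) _
      (cong (2 ^_) (sym (prefix-zero c))) step)
    (cong (2 ^_) (trans (prefix-all c) (sum-indicator C)))
    where
    body = when (1 [ var 9 ]) (4 := var 4 ⊕ var 4)
    step : ∀ (v : Fin n) τ → reg τ 9 ≡ toℕ v → Agree (for 9 0 body) (setReg 4 1 σ) τ →
      reg τ 4 ≡ 2 ^ prefix c (toℕ v) → reg (run body τ) 4 ≡ 2 ^ prefix c (suc (toℕ v))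
    step v τ v≡ a old rewrite prefix-suc c v = when-rule (1 [ var 9 ]) (4 := var 4 ⊕ var 4) {τ}
      (λ ρ → reg ρ 4 ≡ 2 ^ (prefix c (toℕ v) + c v))
      (λ eq → trans (cong₂ _+_ old old) (trans (cong (2 ^ prefix c (toℕ v) +_) (sym (+-identityʳ _)))
        (cong (2 ^_) (trans (+-comm 1 _)
            (cong (prefix c (toℕ v) +_) (sym (cong bit (bit-suc (trans (sym c≡) eq)))))))))
      (λ eq → trans old (cong (2 ^_)
          (trans (sym (+-identityʳ _)) (cong (prefix c (toℕ v) +_) (sym (trans (sym c≡) eq))))))
      where
      c≡ : arr τ 1 (reg τ 9) ≡ c v
      c≡ = trans (cong (arr τ 1) v≡) (trans (cong-app (arrs a 1 _) (toℕ v)) (Inputs.c-arr s v))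

  -- Reading off the answer

  full : Fin L
  full = index {c} (λ _ → ≤-refl)

  toℕ-full : toℕ full ≡ M ∸ 1
  toℕ-full = trans (toℕ-index {c} (λ _ → ≤-refl)) (encode-full C)

  output-spec : ∀ {σ} → Tables σ → ∀ v → arr (run output σ) 0 (toℕ v) ≡ 1 ∸ keptRow σ full v
  output-spec {σ} s v = for-rule 9 0 outputBody Inv n-reg _ (λ v → toℕ-≮0 v) step v (toℕ<n v)
    where
    open Tables s
    Inv : ℕ → Store → Set
    Inv k τ = ∀ v → toℕ v < k → arr τ 0 (toℕ v) ≡ 1 ∸ keptRow σ full v
    step : ∀ v τ → reg τ 9 ≡ toℕ v → Agree output σ τ → Inv (toℕ v) τ → Inv (suc (toℕ v))
        (tick 9 (run outputBody τ))
    step v τ v≡ a old = below-suc (λ u → arr (run outputBody τ) 0 (toℕ u) ≡ 1 ∸ keptRow σ full u) v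
      (λ u u<v → trans (update-≢ (arr τ 0) (λ eq → <⇒≢ u<v (trans eq v≡))) (old u u<v))
      (trans (cong (arr (run outputBody τ) 0) (sym v≡)) (trans (update-≡ (arr τ 0) (reg τ 9))
        (cong (1 ∸_) (trans (cong-app (arrs a 8 _) _) (cong (arr σ 8) address)))))
      where
      address : arr τ 4 (reg τ 4 ∸ 1) + reg τ 9 ≡ at full v
      address = cong₂ _+_ (trans (cong-app (arrs a 4 _) _)
        (trans (cong (arr σ 4) (trans (cong (_∸ 1) (trans (regs a 4 _) M-reg)) (sym toℕ-full)))
            (base-arr full))) v≡

  -- Abstract in flag and output, so that it applies both before and after the flag is stored in
  -- register 0.
  Answered : ℕ → (Fin n → ℕ) → Set
  Answered b out = (b ≡ 0 × (∀ {r K} → r ≤ n → ¬ Partition r c K))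
    ⊎ (b ≡ 1 × ∃[ r ] ∃[ K ] Partition r c K × (∀ {r′ K′} → r′ ≤ n → Partition r′ c K′ → value K′ ≤ value K)
       × (∀ v → out v ≡ 1 ∸ K v))

  Answer : Store → Set
  Answer τ = Answered (1 ∸ (1 ∸ arr τ 7 (reg τ 4 ∸ 1))) (λ v → arr τ 0 (toℕ v))

  output-answer : ∀ {σ} → Tables σ → Sound σ → Complete n σ → Answer (run output σ)
  output-answer {σ} s sound complete = answer _ flag≡
    where
    τ = run output σ
    flag≡ : arr τ 7 (reg τ 4 ∸ 1) ≡ best σ full
    flag≡ = trans (cong-app (arrs (run-agree output σ) 7 _) _)
      (cong (arr σ 7) (trans (cong (_∸ 1) (trans (regs (run-agree output σ) 4 _) (Tables.M-reg s)))
          (sym toℕ-full)))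
    bounds : ∀ {r K} → r ≤ n → Partition r c K →
      0 < best σ full × suc (value K) ≤ best σ full + value isolated
    bounds = complete (λ _ → ≤-refl)
    answer : ∀ b → b ≡ best σ full → Answered (1 ∸ (1 ∸ b)) (λ v → arr τ 0 (toℕ v))
    answer zero    eq = inj₁ (refl , λ r≤n p → contradiction (sym eq) (>⇒≢ (proj₁ (bounds r≤n p))))
    answer (suc b) eq with sound full (subst (0 <_) eq z<s)
    ... | r , p , value≡ = inj₂ (cong (1 ∸_) (0∸n≡0 b) , r , keptRow σ full ,
      partition-resp (λ v → sym (row-index {c} (λ _ → ≤-refl) v)) (λ _ → refl) p ,
      (λ {_} {K′} r′≤n p′ → ≤-pred (subst (suc (value K′) ≤_) value≡ (proj₂ (bounds r′≤n p′)))) ,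
      output-spec s)

  prepare-spec : ∀ {σ} → Sizes σ → (∀ i → arr σ 6 i ≡ 0) → (∀ i → arr σ 7 i ≡ 0) →
    Tables (run prepare σ) × Sound (run prepare σ) × Complete 0 (run prepare σ)
  prepare-spec {σ} s zeros₆ zeros₇ =
    keep-tables (run-agree start σ₃) _ s₃ , start-spec (Tables.layout s₃) z₃
    where
    σ₁ = run multiples σ
    σ₂ = run halves σ₁
    σ₃ = run rows σ₂
    s₁ : Layout σ₁
    s₁ = multiples-spec s
    s₂ : Layout σ₂
    s₂ = keep-layout (run-agree halves σ₁) _ s₁
    h₂ : Halves σ₂
    h₂ = halves-spec s₁ λ i → trans (cong-app (arrs (run-agree multiples σ) 6 _) i) (zeros₆ i)
    s₃ : Tables σ₃
    s₃ = rows-spec s₂ h₂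
    z₃ : ∀ i → arr σ₃ 7 i ≡ 0
    z₃ i = trans (cong-app (arrs (run-agree (multiples ▸ halves ▸ rows) σ) 7 _) i) (zeros₇ i)

  solve-spec : ∀ {σ} → Sizes σ → (∀ i → arr σ 6 i ≡ 0) → (∀ i → arr σ 7 i ≡ 0) → Answer (run solve σ)
  solve-spec {σ} s zeros₆ zeros₇ =
    output-answer (keep-tables (run-agree rounds (run prepare σ)) _ (proj₁ prepared)) (proj₁ rounded)
        (proj₂ rounded)
    where
    prepared : Tables (run prepare σ) × Sound (run prepare σ) × Complete 0 (run prepare σ)
    prepared = prepare-spec s zeros₆ zeros₇
    rounded : Sound (run rounds (run prepare σ)) × Complete n (run rounds (run prepare σ))
    rounded = rounds-spec (proj₁ prepared) (proj₁ (proj₂ prepared)) (proj₂ (proj₂ prepared))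

-- Running time and answer

block-toℕ : ∀ {m} (f : Fin m → ℕ) v → block f (toℕ v) ≡ f v
block-toℕ {m} f v with toℕ v <? m
... | yes p = cong f (fromℕ<-toℕ v p)
... | no ¬p = contradiction (toℕ<n v) ¬p

^-distribʳ-* : ∀ d m n → (m * n) ^ d ≡ m ^ d * n ^ d
^-distribʳ-* zero    m n = refl
^-distribʳ-* (suc d) m n = trans (cong (m * n *_) (^-distribʳ-* d m n)) (*-interchange m n (m ^ d) (n ^ d))

-- The summand 4 pays for the assignment to register 3 between the two stages.
lastCost coefficient exponent : ℕ
lastCost    = 1 + cost flag
coefficient = size countSubsets + (4 + (size solve + lastCost))
exponent    = depth countSubsets ⊔ depth solve

-- Both summands of `suc n + 2 ^ k` are at most their product, so the sum is at most twice the
-- product, whose power separates `n` from `k`.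
time-bound : ∀ a d n k → a * suc (n + 2 ^ k) ^ d ≤ a * 2 ^ d * 2 ^ (d * k) * suc n ^ d
time-bound a d n k = begin
  a * suc (n + M) ^ d                     ≤⟨ *-monoʳ-≤ a (^-monoˡ-≤ d base) ⟩
  a * (2 * M * suc n) ^ d                 ≡⟨ cong (a *_) (^-distribʳ-* d (2 * M) (suc n)) ⟩
  a * ((2 * M) ^ d * suc n ^ d)           ≡⟨ cong (λ x → a * (x * suc n ^ d)) (^-distribʳ-* d 2 M) ⟩
  a * (2 ^ d * M ^ d * suc n ^ d)         ≡⟨ cong (λ x → a * (2 ^ d * x * suc n ^ d))
      (trans (^-*-assoc 2 k d) (cong (2 ^_) (*-comm k d))) ⟩
  a * (2 ^ d * 2 ^ (d * k) * suc n ^ d)   ≡⟨ *-assoc a (2 ^ d * 2 ^ (d * k)) (suc n ^ d) ⟨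
  a * (2 ^ d * 2 ^ (d * k)) * suc n ^ d   ≡⟨ cong (_* suc n ^ d) (*-assoc a (2 ^ d) (2 ^ (d * k))) ⟨
  a * 2 ^ d * 2 ^ (d * k) * suc n ^ d     ∎
  where
  open ≤-Reasoning
  M = 2 ^ k
  1≤M : 1 ≤ M
  1≤M = m^n>0 2 k
  base : suc (n + M) ≤ 2 * M * suc n
  base = begin
    suc n + M                   ≤⟨ +-mono-≤ (m≤n*m (suc n) M {{>-nonZero 1≤M}}) (m≤m*n M (suc n)) ⟩
    M * suc n + M * suc n       ≡⟨ *-distribʳ-+ (suc n) M M ⟨
    (M + M) * suc n             ≡⟨ cong (λ x → (M + x) * suc n) (+-identityʳ M) ⟨
    2 * M * suc n               ∎

bound-stages : ∀ {B t₁ t₂} s₁ s₂ d₁ d₂ k → t₁ ≤ bound B s₁ d₁ → t₂ ≤ bound B s₂ d₂ →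
  t₁ + (4 + (t₂ + k)) ≤ bound B (s₁ + (4 + (s₂ + k))) (d₁ ⊔ d₂)
bound-stages {B} {t₁} {t₂} s₁ s₂ d₁ d₂ k t₁≤ t₂≤ = begin
  t₁ + (4 + (t₂ + k))
    ≤⟨ +-mono-≤ (≤-trans t₁≤ (bound-monoʳ B s₁ (m≤m⊔n d₁ d₂))) (+-mono-≤ (≤bound B 4 d)
         (+-mono-≤ (≤-trans t₂≤ (bound-monoʳ B s₂ (m≤n⊔m d₁ d₂))) (≤bound B k d))) ⟩
  bound B s₁ d + (bound B 4 d + (bound B s₂ d + bound B k d))
    ≡⟨ cong (λ x → bound B s₁ d + (bound B 4 d + x)) (bound-+ B s₂ k d) ⟩
  bound B s₁ d + (bound B 4 d + bound B (s₂ + k) d)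
    ≡⟨ cong (bound B s₁ d +_) (bound-+ B 4 (s₂ + k) d) ⟩
  bound B s₁ d + bound B (4 + (s₂ + k)) d
    ≡⟨ bound-+ B s₁ (4 + (s₂ + k)) d ⟩
  bound B (s₁ + (4 + (s₂ + k))) d ∎
  where
  open ≤-Reasoning
  d = d₁ ⊔ d₂

module _ (I : Instance) where
  open Instance I
  open Partitions I
  open Feasibility I
  open Correct I

  private
    σ₀ = input I
    σ₁ = run countSubsets σ₀
    σ₂ = setReg 3 (reg σ₁ 0 + reg σ₁ 4) σ₁
    σ₃ = run solve σ₂

  input-inputs : Inputs σ₀
  input-inputs = record
    { n-reg = refl ; sign-reg = refl ; abs-reg = refl
    ; w-arr = block-toℕ w
    ; c-arr = block-toℕ (indicator C)
    ; e-arr = λ v u → trans (cong (block adjacency) (sym (toℕ-combine v u)))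
        (trans (block-toℕ adjacency (combine v u))
          (cong (λ p → bit (uncurry (Graph.adj G) p)) (remQuot-combine v u))) }
    where
    adjacency : Fin (n * n) → ℕ
    adjacency k = bit (uncurry (Graph.adj G) (remQuot {n} n k))

  sizes-σ₂ : Sizes σ₂
  sizes-σ₂ = record
    { inputs = keep-inputs (run-agree (countSubsets ▸ 3 := var 0 ⊕ var 4) σ₀) _ input-inputs
    ; L-reg = cong₂ _+_ (regs (run-agree countSubsets σ₀) 0 _) (count-spec input-inputs)
    ; M-reg = count-spec input-inputs }

  final : Store
  final = setReg 0 (⟦ flag ⟧ σ₃) σ₃

  bounded₀ : Bounded L σ₀
  bounded₀ 0 _ = m≤m+n n M
  bounded₀ 3 _ = z≤n

  bounded₂ : Bounded L σ₂
  bounded₂ 0 _ = ≤-trans (≤-reflexive (Sizes.n-reg sizes-σ₂)) (m≤m+n n M)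
  bounded₂ 3 _ = ≤-reflexive (Sizes.L-reg sizes-σ₂)

  combine-runs : Terminates L countSubsets σ₀ → Terminates L solve σ₂ →
    ∃[ t ] (⟨ algorithm , σ₀ ⟩⇓ final # t) × t ≤ bound L coefficient exponent
  combine-runs (s , count , s≤) (t , solving , t≤) =
    s + (4 + (t + lastCost)) , seq count (seq assign (seq solving assign)) ,
    bound-stages {L} (size countSubsets) (size solve) (depth countSubsets) (depth solve) lastCost s≤ t≤

  running : ∃[ t ] (⟨ algorithm , σ₀ ⟩⇓ final # t) × t ≤ bound L coefficient exponent
  running = combine-runs (terminates L countSubsets σ₀ _ bounded₀) (terminates L solve σ₂ _ bounded₂)

  arrays-zero : ∀ i → arr σ₂ 6 i ≡ 0 × arr σ₂ 7 i ≡ 0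
  arrays-zero i = cong-app (arrs (run-agree countSubsets σ₀) 6 _) i ,
                  cong-app (arrs (run-agree countSubsets σ₀) 7 _) i

  translate : ∀ {τ} → Answered (reg τ 0) (λ v → arr τ 0 (toℕ v)) → Answers I τ
  translate (inj₁ (no-answer , none)) = inj₂ (no-answer , infeasible none)
  translate (inj₂ (answer , r , K , p , best-K , out)) = inj₁ (answer , removed K , optimal p best-K ,
    λ v → trans (out v) (sym (indicator-removed K v)))

  answers : Answers I final
  answers = translate {final}
      (solve-spec sizes-σ₂ (λ i → proj₁ (arrays-zero i)) (λ i → proj₂ (arrays-zero i)))

theorem15 : ∃[ P ] ∃[ a ] ∃[ b ] ∃[ c ] ((I : Instance) → let open Instance I in
    ∃[ τ ] ∃[ t ] (⟨ P , input I ⟩⇓ τ # t) × t ≤ a * 2 ^ (b * card C) * suc n ^ c × Answers I τ)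
-- Every loop is charged `L` passes, even those over vertices. So the nesting depth, which is 5,
-- serves as both exponents, although only three nested loops run over subsets.
theorem15 = algorithm , coefficient * 2 ^ exponent , exponent , exponent , λ I →
  let (t , runs , t≤) = running I
  in final I , t , runs , ≤-trans t≤
      (time-bound coefficient exponent (Instance.n I) (card (Instance.C I))) , answers I
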